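{- There is a unique shift for which, asymptotically, half of the integers in an $\alpha$-shifted, $\nu$-offset, floor sequence are odd and half are even, and it does not depend on $\nu$. Precisely: there exists $\alpha_0\in[0,1]$ such that, for every $\nu\in\mathbb{R}$, $\alpha_0$ is the unique $\alpha\in[0,1]$ satisfying $$\lim_{n\to\infty}\frac{1}{n}\mathcal{N}_{n,\alpha,\nu,1,2}=\lim_{n\to\infty}\frac{1}{n}\mathcal{N}_{n,\alpha,\nu,2,2}=\frac12.$$
   Context: For $\alpha,\nu\in\mathbb{R}$ and a positive integer $n$, the $\alpha$-shifted, $\nu$-offset, floor sequence of length $n$ is $\left\lfloor\frac{n-\nu}{1}+\alpha\right\rfloor,\left\lfloor\frac{n-\nu}{2}+\alpha\right\rfloor,\dots,\left\lfloor\frac{n-\nu}{n}+\alpha\right\rfloor$. For $r\in\mathbb{Z}$ and a positive integer $m$, $$\mathcal{N}_{n,\alpha,\nu,r,m}=\#\left\{k\in\mathbb{Z} : 1\le k\le n,\ \left\lfloor\frac{n-\nu}{k}+\alpha\right\rfloor\equiv r \pmod m\right\}$$ is the number of terms of this sequence congruent to $r$ modulo $m$; so $\mathcal{N}_{n,\alpha,\nu,1,2}$ counts the odd terms and $\mathcal{N}_{n,\alpha,\nu,2,2}$ the even terms. -}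

module Defs where

open import Axiom.ExcludedMiddle using (ExcludedMiddle)
open import Data.Integer.Base as ℤ using (ℤ; +_)
open import Data.Integer.Divisibility.Signed as ℤ using (_∣?_)
import Data.Integer.DivMod as ℤ
import Data.Integer.Properties as ℤ
open import Data.List.Base using (filter; length; upTo)
open import Data.Nat.Base as ℕ using (ℕ; suc)
import Data.Nat.Properties as ℕ
open import Data.Product.Base using (_×_; _,_; ∃; proj₁; proj₂)
open import Data.Rational.Base as ℚ using (ℚ; 0ℚ; 1ℚ; ½; ∣_∣; *≤*; *<*)
import Data.Rational.Properties as ℚ
import Data.Rational.Unnormalised.Base as ℚᵘ
import Data.Rational.Unnormalised.Properties as ℚᵘ
open import Data.Rational.Solver using (module +-*-Solver)
open import Data.Sum.Base using (inj₁; inj₂)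
open import Level using (0ℓ)
open import Relation.Binary.PropositionalEquality
  using (_≡_; refl; sym; trans; cong; subst; subst₂)
open import Relation.Nullary using (¬_; yes; no; contradiction)

fromℤ : ℤ → ℚ
fromℤ z = z ℚ./ 1

private
  0<½ : 0ℚ ℚ.< ½
  0<½ = *<* (ℤ.+<+ (ℕ.s≤s ℕ.z≤n))

  half-pos : ∀ {ε} → 0ℚ ℚ.< ε → 0ℚ ℚ.< ½ ℚ.* ε
  half-pos {ε} 0<ε = subst (ℚ._< ½ ℚ.* ε) (ℚ.*-zeroʳ ½) (ℚ.*-monoʳ-<-pos ½ 0<ε)

  half+half : ∀ ε → ½ ℚ.* ε ℚ.+ ½ ℚ.* ε ≡ ε
  half+half ε = trans (sym (ℚ.*-distribʳ-+ ε ½ ½)) (ℚ.*-identityˡ ε)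

  1/k≤1 : ∀ k .{{_ : ℕ.NonZero k}} → (+ 1) ℚ./ k ℚ.≤ 1ℚ
  1/k≤1 (suc j) = ℚ.toℚᵘ-cancel-≤
    (ℚᵘ.≤-respˡ-≃ (ℚᵘ.≃-sym (ℚ.toℚᵘ-fromℚᵘ (ℚᵘ.mkℚᵘ (+ 1) j)))
      (ℚᵘ.*≤* (ℤ.+≤+ (ℕ.s≤s ℕ.z≤n))))

  1/k≥0 : ∀ k .{{_ : ℕ.NonZero k}} → 0ℚ ℚ.≤ (+ 1) ℚ./ k
  1/k≥0 k = ℚ.nonNegative⁻¹ ((+ 1) ℚ./ k) {{ℚ.normalize-nonNeg 1 k}}

  ∣x-x∣≡0 : ∀ x → ∣ x ℚ.- x ∣ ≡ 0ℚ
  ∣x-x∣≡0 x = cong ∣_∣ (ℚ.+-inverseʳ x)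

-- Cauchy sequences of rationals; equality of real numbers is _≃_, not _≡_.
record ℝ : Set where
  constructor mkℝ
  field
    seq    : ℕ → ℚ
    cauchy : ∀ ε → 0ℚ ℚ.< ε →
             ∃ λ M → ∀ i j → M ℕ.≤ i → M ℕ.≤ j → ∣ seq i ℚ.- seq j ∣ ℚ.< ε

open ℝ public

infix  4 _≃_ _<_ _≤_ _⟶_
infixl 6 _+_ _-_
infixl 7 _/_
infix  8 -_

_≃_ : ℝ → ℝ → Set
x ≃ y = ∀ ε → 0ℚ ℚ.< ε → ∃ λ M → ∀ i → M ℕ.≤ i → ∣ seq x i ℚ.- seq y i ∣ ℚ.< ε

-- A uniform gap ε is needed: termwise strict inequality can vanish in the limit.
_<_ : ℝ → ℝ → Set
x < y = ∃ λ ε → 0ℚ ℚ.< ε × ∃ λ M → ∀ i → M ℕ.≤ i → seq x i ℚ.+ ε ℚ.≤ seq y i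

_≤_ : ℝ → ℝ → Set
x ≤ y = ¬ (y < x)

fromℚ : ℚ → ℝ
fromℚ q = mkℝ (λ _ → q) λ ε 0<ε →
  0 , λ _ _ _ _ → subst (ℚ._< ε) (sym (∣x-x∣≡0 q)) 0<ε

0ℝ 1ℝ : ℝ
0ℝ = fromℚ 0ℚ
1ℝ = fromℚ 1ℚ

_+_ : ℝ → ℝ → ℝ
x + y = mkℝ (λ i → seq x i ℚ.+ seq y i) λ ε 0<ε →
  let (M , hx) = cauchy x (½ ℚ.* ε) (half-pos 0<ε)
      (N , hy) = cauchy y (½ ℚ.* ε) (half-pos 0<ε)
  in M ℕ.⊔ N , λ i j M⊔N≤i M⊔N≤j → begin-strict
    ∣ (seq x i ℚ.+ seq y i) ℚ.- (seq x j ℚ.+ seq y j) ∣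
      ≡⟨ cong ∣_∣ (swap (seq x i) (seq y i) (seq x j) (seq y j)) ⟩
    ∣ (seq x i ℚ.- seq x j) ℚ.+ (seq y i ℚ.- seq y j) ∣
      ≤⟨ ℚ.∣p+q∣≤∣p∣+∣q∣ (seq x i ℚ.- seq x j) (seq y i ℚ.- seq y j) ⟩
    ∣ seq x i ℚ.- seq x j ∣ ℚ.+ ∣ seq y i ℚ.- seq y j ∣
      <⟨ ℚ.+-mono-< (hx i j (ℕ.m⊔n≤o⇒m≤o M N M⊔N≤i) (ℕ.m⊔n≤o⇒m≤o M N M⊔N≤j))
                    (hy i j (ℕ.m⊔n≤o⇒n≤o M N M⊔N≤i) (ℕ.m⊔n≤o⇒n≤o M N M⊔N≤j)) ⟩
    ½ ℚ.* ε ℚ.+ ½ ℚ.* ε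
      ≡⟨ half+half ε ⟩
    ε ∎
  where
  open ℚ.≤-Reasoning
  swap : ∀ a b c d → (a ℚ.+ b) ℚ.- (c ℚ.+ d) ≡ (a ℚ.- c) ℚ.+ (b ℚ.- d)
  swap = solve 4 (λ a b c d → (a :+ b) :- (c :+ d) := (a :- c) :+ (b :- d)) refl
    where open +-*-Solver

-_ : ℝ → ℝ
- x = mkℝ (λ i → ℚ.- seq x i) λ ε 0<ε →
  let (M , hx) = cauchy x ε 0<ε
  in M , λ i j M≤i M≤j → subst (ℚ._< ε) (eq (seq x i) (seq x j)) (hx i j M≤i M≤j)
  where
  eq : ∀ a b → ∣ a ℚ.- b ∣ ≡ ∣ (ℚ.- a) ℚ.- (ℚ.- b) ∣
  eq a b = trans (sym (ℚ.∣-p∣≡∣p∣ (a ℚ.- b))) (cong ∣_∣ (ℚ.neg-distrib-+ a (ℚ.- b)))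

_-_ : ℝ → ℝ → ℝ
x - y = x + (- y)

_/_ : ℝ → (k : ℕ) → .{{ℕ.NonZero k}} → ℝ
x / k = mkℝ (λ i → seq x i ℚ.* 1/k) λ ε 0<ε →
  let (M , hx) = cauchy x ε 0<ε
  in M , λ i j M≤i M≤j → begin-strict
    ∣ seq x i ℚ.* 1/k ℚ.- seq x j ℚ.* 1/k ∣
      ≡⟨ cong ∣_∣ (factor (seq x i) (seq x j)) ⟩
    ∣ (seq x i ℚ.- seq x j) ℚ.* 1/k ∣
      ≡⟨ ℚ.∣p*q∣≡∣p∣*∣q∣ (seq x i ℚ.- seq x j) 1/k ⟩
    ∣ seq x i ℚ.- seq x j ∣ ℚ.* ∣ 1/k ∣
      ≡⟨ cong (∣ seq x i ℚ.- seq x j ∣ ℚ.*_) (ℚ.0≤p⇒∣p∣≡p (1/k≥0 k)) ⟩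
    ∣ seq x i ℚ.- seq x j ∣ ℚ.* 1/k
      ≤⟨ ℚ.*-monoˡ-≤-nonNeg ∣ seq x i ℚ.- seq x j ∣
           {{ℚ.nonNegative (ℚ.0≤∣p∣ (seq x i ℚ.- seq x j))}} (1/k≤1 k) ⟩
    ∣ seq x i ℚ.- seq x j ∣ ℚ.* 1ℚ
      ≡⟨ ℚ.*-identityʳ _ ⟩
    ∣ seq x i ℚ.- seq x j ∣
      <⟨ hx i j M≤i M≤j ⟩
    ε ∎
  where
  open ℚ.≤-Reasoning
  1/k : ℚ
  1/k = (+ 1) ℚ./ k
  factor : ∀ a b → a ℚ.* 1/k ℚ.- b ℚ.* 1/k ≡ (a ℚ.- b) ℚ.* 1/k
  factor a b = solve 3 (λ a b c → a :* c :- b :* c := (a :- b) :* c) refl a b 1/k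
    where open +-*-Solver

IsFloor : ℝ → ℤ → Set
IsFloor x z = fromℚ (fromℤ z) ≤ x × x < fromℚ (fromℤ (ℤ.suc z))

private
  toℚᵘ-fromℤ : ∀ z → ℚ.toℚᵘ (fromℤ z) ℚᵘ.≃ ℚᵘ.mkℚᵘ z 0
  toℚᵘ-fromℤ z = ℚ.toℚᵘ-fromℚᵘ (ℚᵘ.mkℚᵘ z 0)

  floor-≤ : ∀ q → fromℤ (ℚ.floor q) ℚ.≤ q
  floor-≤ q@record{} = ℚ.toℚᵘ-cancel-≤
    (ℚᵘ.≤-respˡ-≃ (ℚᵘ.≃-sym (toℚᵘ-fromℤ (ℚ.floor q)))
      (ℚᵘ.*≤* (subst (ℚ.floor q ℤ.* ℚ.↧ q ℤ.≤_) (sym (ℤ.*-identityʳ (ℚ.↥ q)))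
        (ℤ.[n/d]*d≤n (ℚ.↥ q) (ℚ.↧ q)))))

  <-suc-floor : ∀ q → q ℚ.< fromℤ (ℤ.suc (ℚ.floor q))
  <-suc-floor q@record{} = ℚ.toℚᵘ-cancel-<
    (ℚᵘ.<-respʳ-≃ (ℚᵘ.≃-sym (toℚᵘ-fromℤ (ℤ.suc (ℚ.floor q))))
      (ℚᵘ.*<* (subst₂ ℤ._<_ (sym (ℤ.*-identityʳ (ℚ.↥ q)))
          (cong (λ w → ℤ.suc w ℤ.* ℚ.↧ q) (sym (ℤ.div-pos-is-/ℕ (ℚ.↥ q) (ℚ.↧ₙ q))))
        (ℤ.n<s[n/ℕd]*d (ℚ.↥ q) (ℚ.↧ₙ q)))))

  fromℤ-suc : ∀ z → fromℤ (ℤ.suc z) ≡ 1ℚ ℚ.+ fromℤ z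
  fromℤ-suc z = ℚ.toℚᵘ-injective (ℚᵘ.≃-trans (toℚᵘ-fromℤ (ℤ.suc z))
    (ℚᵘ.≃-trans (ℚᵘ.*≡* eq)
      (ℚᵘ.≃-sym (ℚᵘ.≃-trans (ℚ.toℚᵘ-homo-+ 1ℚ (fromℤ z))
        (ℚᵘ.+-congʳ ℚᵘ.1ℚᵘ (toℚᵘ-fromℤ z))))))
    where
    eq : ℤ.suc z ℤ.* (+ 1) ≡ ((+ 1) ℤ.* (+ 1) ℤ.+ z ℤ.* (+ 1)) ℤ.* (+ 1)
    eq = cong (λ w → ((+ 1) ℤ.+ w) ℤ.* (+ 1)) (sym (ℤ.*-identityʳ z))

  ∣p∣<ε⇒p<ε : ∀ {p ε} → ∣ p ∣ ℚ.< ε → p ℚ.< ε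
  ∣p∣<ε⇒p<ε {p} = ℚ.≤-<-trans (p≤∣p∣ p)
    where
    p≤∣p∣ : ∀ p → p ℚ.≤ ∣ p ∣
    p≤∣p∣ p with ℚ.≤-total 0ℚ p
    ... | inj₁ 0≤p = ℚ.≤-reflexive (sym (ℚ.0≤p⇒∣p∣≡p 0≤p))
    ... | inj₂ p≤0 = ℚ.≤-trans p≤0 (ℚ.0≤∣p∣ p)

floor-exists : ExcludedMiddle 0ℓ → ∀ x → ∃ (IsFloor x)
floor-exists em x with cauchy x 1ℚ (*<* (ℤ.+<+ (ℕ.s≤s ℕ.z≤n)))
... | M , near = search
  where
  q : ℚ
  q = seq x M

  a : ℤ
  a = ℚ.floor (q ℚ.- 1ℚ)

  b : ℤ
  b = ℤ.suc (ℤ.suc (ℤ.suc a))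

  a≤x : fromℚ (fromℤ a) ≤ x
  a≤x (ε , 0<ε , N , h) = ℚ.<-irrefl refl (begin-strict
    q ℚ.- 1ℚ                        <⟨ ℚ.+-monoʳ-< q (ℚ.neg-antimono-< (∣p∣<ε⇒p<ε (near M i ℕ.≤-refl M≤i))) ⟩
    q ℚ.- (q ℚ.- seq x i)           ≡⟨ cancel q (seq x i) ⟩
    seq x i                         ≡⟨ ℚ.+-identityʳ (seq x i) ⟨
    seq x i ℚ.+ 0ℚ                  <⟨ ℚ.+-monoʳ-< (seq x i) 0<ε ⟩
    seq x i ℚ.+ ε                   ≤⟨ h i (ℕ.m≤n⊔m M N) ⟩
    fromℤ a                         ≤⟨ floor-≤ (q ℚ.- 1ℚ) ⟩
    q ℚ.- 1ℚ                        ∎)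
    where
    open ℚ.≤-Reasoning
    i : ℕ
    i = M ℕ.⊔ N
    M≤i : M ℕ.≤ i
    M≤i = ℕ.m≤m⊔n M N
    cancel : ∀ p r → p ℚ.- (p ℚ.- r) ≡ r
    cancel = solve 2 (λ p r → p :- (p :- r) := r) refl
      where open +-*-Solver

  q+1<b : q ℚ.+ 1ℚ ℚ.< fromℤ b
  q+1<b = begin-strict
    q ℚ.+ 1ℚ                              ≡⟨ shift q 1ℚ ⟩
    1ℚ ℚ.+ (1ℚ ℚ.+ (q ℚ.- 1ℚ))            <⟨ ℚ.+-monoʳ-< 1ℚ (ℚ.+-monoʳ-< 1ℚ (<-suc-floor (q ℚ.- 1ℚ))) ⟩
    1ℚ ℚ.+ (1ℚ ℚ.+ fromℤ (ℤ.suc a))       ≡⟨ cong (1ℚ ℚ.+_) (fromℤ-suc (ℤ.suc a)) ⟨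
    1ℚ ℚ.+ fromℤ (ℤ.suc (ℤ.suc a))        ≡⟨ fromℤ-suc (ℤ.suc (ℤ.suc a)) ⟨
    fromℤ b                               ∎
    where
    open ℚ.≤-Reasoning
    shift : ∀ p r → p ℚ.+ r ≡ r ℚ.+ (r ℚ.+ (p ℚ.- r))
    shift = solve 2 (λ p r → p :+ r := r :+ (r :+ (p :- r))) refl
      where open +-*-Solver

  x<b : x < fromℚ (fromℤ b)
  x<b = δ , 0<δ , M , λ i M≤i → begin
    seq x i ℚ.+ δ                        ≡⟨ shift (seq x i) q δ ⟩
    (seq x i ℚ.- q) ℚ.+ (q ℚ.+ δ)        ≤⟨ ℚ.+-monoˡ-≤ (q ℚ.+ δ) (ℚ.<⇒≤ (∣p∣<ε⇒p<ε (near i M M≤i ℕ.≤-refl))) ⟩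
    1ℚ ℚ.+ (q ℚ.+ δ)                     ≡⟨ cancel 1ℚ q (fromℤ b) ⟩
    fromℤ b                              ∎
    where
    open ℚ.≤-Reasoning
    δ : ℚ
    δ = fromℤ b ℚ.- (q ℚ.+ 1ℚ)
    0<δ : 0ℚ ℚ.< δ
    0<δ = subst (ℚ._< δ) (ℚ.+-inverseʳ (q ℚ.+ 1ℚ)) (ℚ.+-monoˡ-< (ℚ.- (q ℚ.+ 1ℚ)) q+1<b)
    shift : ∀ s p d → s ℚ.+ d ≡ (s ℚ.- p) ℚ.+ (p ℚ.+ d)
    shift = solve 3 (λ s p d → s :+ d := (s :- p) :+ (p :+ d)) refl
      where open +-*-Solver
    cancel : ∀ o p c → o ℚ.+ (p ℚ.+ (c ℚ.- (p ℚ.+ o))) ≡ c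
    cancel = solve 3 (λ o p c → o :+ (p :+ (c :- (p :+ o))) := c) refl
      where open +-*-Solver

  search : ∃ (IsFloor x)
  search with em {x < fromℚ (fromℤ (ℤ.suc a))}
  ... | yes x<a+1 = a , a≤x , x<a+1
  ... | no  a+1≤x with em {x < fromℚ (fromℤ (ℤ.suc (ℤ.suc a)))}
  ...   | yes x<a+2 = ℤ.suc a , a+1≤x , x<a+2
  ...   | no  a+2≤x = ℤ.suc (ℤ.suc a) , a+2≤x , x<b

-- The floor of a real number is not computable, so it takes excluded middle
-- as an argument.
⌊_⌋[_] : ℝ → ExcludedMiddle 0ℓ → ℤ
⌊ x ⌋[ em ] = proj₁ (floor-exists em x)

-- The k-th term, k ≥ 1, of the α-shifted, ν-offset, floor sequence of length n
term : ExcludedMiddle 0ℓ → (n : ℕ) (α ν : ℝ) (k : ℕ) → .{{ℕ.NonZero k}} → ℤ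
term em n α ν k = ⌊ (fromℚ (fromℤ (+ n)) - ν) / k + α ⌋[ em ]

-- The index i ∈ {0, …, n - 1} stands for k = i + 1 ∈ {1, …, n}.
𝒩 : ExcludedMiddle 0ℓ → (n : ℕ) (α ν : ℝ) (r : ℤ) (m : ℕ) → .{{ℕ.NonZero m}} → ℕ
𝒩 em n α ν r m =
  length (filter (λ i → + m ∣? (term em n α ν (suc i) ℤ.- r)) (upTo n))

density : ExcludedMiddle 0ℓ → (α ν : ℝ) (r : ℤ) (m : ℕ) → .{{ℕ.NonZero m}} →
          (n : ℕ) → .{{ℕ.NonZero n}} → ℚ
density em α ν r m n = (+ 𝒩 em n α ν r m) ℚ./ n

-- Limit of a rational sequence indexed by the positive integers; rational ε
-- suffice, since below every positive real there is a positive rational.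
_⟶_ : ((n : ℕ) → .{{ℕ.NonZero n}} → ℚ) → ℚ → Set
u ⟶ L = ∀ ε → 0ℚ ℚ.< ε →
  ∃ λ M → ∀ n → .{{_ : ℕ.NonZero n}} → M ℕ.≤ n → ∣ u n ℚ.- L ∣ ℚ.< ε

HalfOddHalfEven : ExcludedMiddle 0ℓ → (α ν : ℝ) → Set
HalfOddHalfEven em α ν =
  (density em α ν (+ 1) 2 ⟶ ½) × (density em α ν (+ 2) 2 ⟶ ½)

{-# OPTIONS --safe #-}

-- For a term t ≥ 0, the parity of t is the alternating sum over i ≥ 1 of the
-- indicators of t ≥ i, truncated at any level m with an error at most the
-- indicator of t > m.  The terms ≥ i are those with k (i - α) ≤ n - ν, so there
-- are n / (i - α) + O(1) of them (n + O(1) for i = 1), and the odd terms have density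
--   S(α) = 1 - 1/(2 - α) + 1/(3 - α) - …
-- whatever ν is.  S is strictly decreasing on [0,1], quantitatively
-- (b - a)/12 ≤ S(a) - S(b) ≤ b - a for a ≤ b, with S(0) ≥ 1/2 ≥ S(1), so it
-- takes the value 1/2 exactly once.  All estimates are made at rational a close
-- to α and for the partial sums of S; α₀ is the Cauchy sequence of approximate
-- solutions of S = 1/2 found by a discrete search on finer and finer grids.
module Submission where

open import Axiom.ExcludedMiddle using (ExcludedMiddle)
open import Data.Bool.Base using (Bool; true; false)
import Data.Bool.Properties as Bool
open import Data.Integer.Base as ℤ using (ℤ; +_)
open import Data.Integer.Divisibility.Signed as ℤ using (_∣?_)
import Data.Integer.Properties as ℤ
open import Data.List.Base using ([]; _∷_; filter; length; upTo)
import Data.List.Properties as List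
open import Data.Nat.Base as ℕ using (ℕ; zero; suc; _<ᵇ_)
import Data.Nat.Properties as ℕ
open import Data.Product.Base using (_×_; _,_; ∃; proj₁; proj₂)
import Data.Rational.Properties as ℚ
import Data.Rational.Unnormalised.Base as ℚᵘ
import Data.Rational.Unnormalised.Properties as ℚᵘ
open import Data.Sum.Base using (_⊎_; inj₁; inj₂; [_,_]′)
import Defs
open import Function.Base using (_∘_)
open import Function.Bundles using (mk⇔; Equivalence)
open import Level using (0ℓ)
open import Relation.Binary.PropositionalEquality
  using (_≡_; refl; sym; trans; cong; cong₂; subst; subst₂)
open import Relation.Nullary using (¬_; yes; no; contradiction)
open import Relation.Nullary.Decidable using (does; does-⇔; dec⇒maybe; from-yes)
open import Relation.Unary using (Decidable)
open import Tactic.RingSolver using (solve-∀)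
open import Tactic.RingSolver.Core.AlmostCommutativeRing
  using (AlmostCommutativeRing; fromCommutativeRing)

-- A separate module because the operations on ℚ and on ℝ share their names.
module Development where

  open import Data.Rational.Base
  open Defs using (ℝ; mkℝ; seq; cauchy; fromℚ; fromℤ; IsFloor; floor-exists;
                   term; 𝒩; density; _⟶_; HalfOddHalfEven)

  -- Ring identities and order in ℚ

  ring : AlmostCommutativeRing 0ℓ 0ℓ
  ring = fromCommutativeRing ℚ.+-*-commutativeRing λ x → dec⇒maybe (0ℚ ℚ.≟ x)

  p≤q⇒0≤q-p : ∀ {p q} → p ≤ q → 0ℚ ≤ q - p
  p≤q⇒0≤q-p {p} {q} p≤q = subst (_≤ q - p) (ℚ.+-inverseʳ p) (ℚ.+-monoˡ-≤ (- p) p≤q)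

  -- Meant for d a combination of nonnegative differences, so that the equation is
  -- a ring identity.
  ≤-by : ∀ {p q d} → 0ℚ ≤ d → d ≡ q - p → p ≤ q
  ≤-by {p} {q} 0≤d refl = subst₂ _≤_ (ℚ.+-identityʳ p) (cancel p q) (ℚ.+-monoʳ-≤ p 0≤d)
    where
    cancel : ∀ p q → p + (q - p) ≡ q
    cancel = solve-∀ ring

  0≤+ : ∀ {p q} → 0ℚ ≤ p → 0ℚ ≤ q → 0ℚ ≤ p + q
  0≤+ 0≤p 0≤q = ℚ.+-mono-≤ 0≤p 0≤q

  *-monoʳ : ∀ {p q r} → 0ℚ ≤ r → p ≤ q → p * r ≤ q * r
  *-monoʳ {r = r} 0≤r = ℚ.*-monoʳ-≤-nonNeg r {{nonNegative 0≤r}}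

  *-monoˡ : ∀ {p q r} → 0ℚ ≤ r → p ≤ q → r * p ≤ r * q
  *-monoˡ {r = r} 0≤r = ℚ.*-monoˡ-≤-nonNeg r {{nonNegative 0≤r}}

  0≤* : ∀ {p q} → 0ℚ ≤ p → 0ℚ ≤ q → 0ℚ ≤ p * q
  0≤* {p} {q} 0≤p 0≤q = subst (_≤ p * q) (ℚ.*-zeroˡ q) (*-monoʳ 0≤q 0≤p)

  *-mono : ∀ {p q r s} → 0ℚ ≤ p → 0ℚ ≤ r → p ≤ q → r ≤ s → p * r ≤ q * s
  *-mono 0≤p 0≤r p≤q r≤s = ℚ.≤-trans (*-monoʳ 0≤r p≤q) (*-monoˡ (ℚ.≤-trans 0≤p p≤q) r≤s)

  0<1 : 0ℚ < 1ℚ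
  0<1 = *<* (ℤ.+<+ (ℕ.s≤s ℕ.z≤n))

  0≤1 : 0ℚ ≤ 1ℚ
  0≤1 = ℚ.<⇒≤ 0<1

  1≤⇒0≤ : ∀ {p} → 1ℚ ≤ p → 0ℚ ≤ p
  1≤⇒0≤ = ℚ.≤-trans 0≤1

  *-cancelʳ-≤ : ∀ {p q r} → 1ℚ ≤ r → p * r ≤ q * r → p ≤ q
  *-cancelʳ-≤ {r = r} 1≤r =
    ℚ.*-cancelʳ-≤-pos r {{positive (ℚ.<-≤-trans 0<1 1≤r)}}

  -- Distances

  -- Two linear inequalities in place of an absolute value: each can be proved by `≤-by` and a ring
  -- identity, with no case split on signs.
  record _≈[_]_ (p e q : ℚ) : Set where
    constructor within
    field
      upper : p ≤ q + e
      lower : q ≤ p + e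

  open _≈[_]_ public

  infix 4 _≈[_]_

  ≈-refl : ∀ {p} → p ≈[ 0ℚ ] p
  ≈-refl {p} = within p≤p+0 p≤p+0
    where p≤p+0 = ℚ.≤-reflexive (sym (ℚ.+-identityʳ p))

  ≈-sym : ∀ {p q e} → p ≈[ e ] q → q ≈[ e ] p
  ≈-sym (within u l) = within l u

  ≈-trans : ∀ {p q r d e} → p ≈[ d ] q → q ≈[ e ] r → p ≈[ d + e ] r
  ≈-trans {p} {q} {r} {d} {e} (within u l) (within u′ l′) = within
    (≤-by (0≤+ (p≤q⇒0≤q-p u) (p≤q⇒0≤q-p u′)) (eq₁ p q r d e))
    (≤-by (0≤+ (p≤q⇒0≤q-p l) (p≤q⇒0≤q-p l′)) (eq₂ p q r d e))
    where
    eq₁ : ∀ p q r d e → (q + d - p) + (r + e - q) ≡ (r + (d + e)) - p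
    eq₁ = solve-∀ ring
    eq₂ : ∀ p q r d e → (p + d - q) + (q + e - r) ≡ (p + (d + e)) - r
    eq₂ = solve-∀ ring

  ≈-weaken : ∀ {p q d e} → d ≤ e → p ≈[ d ] q → p ≈[ e ] q
  ≈-weaken {p} {q} d≤e (within u l) =
    within (ℚ.≤-trans u (ℚ.+-monoʳ-≤ q d≤e)) (ℚ.≤-trans l (ℚ.+-monoʳ-≤ p d≤e))

  ≈-subtract : ∀ {p p′ q q′ d e} → p ≈[ d ] p′ → q ≈[ e ] q′ → p - q ≈[ d + e ] p′ - q′
  ≈-subtract {p} {p′} {q} {q′} {d} {e} (within u l) (within u′ l′) = within
    (≤-by (0≤+ (p≤q⇒0≤q-p u) (p≤q⇒0≤q-p l′)) (eq p p′ q q′ d e))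
    (≤-by (0≤+ (p≤q⇒0≤q-p l) (p≤q⇒0≤q-p u′)) (eq p′ p q′ q d e))
    where
    eq : ∀ p p′ q q′ d e → (p′ + d - p) + (q + e - q′) ≡ ((p′ - q′) + (d + e)) - (p - q)
    eq = solve-∀ ring

  ≈-add : ∀ {p p′ q q′ d e} → p ≈[ d ] p′ → q ≈[ e ] q′ → p + q ≈[ d + e ] p′ + q′
  ≈-add {p} {p′} {q} {q′} {d} {e} (within u l) (within u′ l′) = within
    (≤-by (0≤+ (p≤q⇒0≤q-p u) (p≤q⇒0≤q-p u′)) (eq p p′ q q′ d e))
    (≤-by (0≤+ (p≤q⇒0≤q-p l) (p≤q⇒0≤q-p l′)) (eq p′ p q′ q d e))
    where
    eq : ∀ p p′ q q′ d e → (p′ + d - p) + (q′ + e - q) ≡ ((p′ + q′) + (d + e)) - (p + q)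
    eq = solve-∀ ring

  p≤∣p∣ : ∀ p → p ≤ ∣ p ∣
  p≤∣p∣ p with ℚ.≤-total 0ℚ p
  ... | inj₁ 0≤p = ℚ.≤-reflexive (sym (ℚ.0≤p⇒∣p∣≡p 0≤p))
  ... | inj₂ p≤0 = ℚ.≤-trans p≤0 (ℚ.0≤∣p∣ p)

  ∣-∣≤⇒≈ : ∀ {p q e} → ∣ p - q ∣ ≤ e → p ≈[ e ] q
  ∣-∣≤⇒≈ {p} {q} {e} h = within
    (≤-by (p≤q⇒0≤q-p (ℚ.≤-trans (p≤∣p∣ (p - q)) h)) (eq₁ p q e))
    (≤-by (p≤q⇒0≤q-p (ℚ.≤-trans (p≤∣p∣ (- (p - q))) (subst (_≤ e) (sym (ℚ.∣-p∣≡∣p∣ (p - q))) h)))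
          (eq₂ p q e))
    where
    eq₁ : ∀ p q e → e - (p - q) ≡ (q + e) - p
    eq₁ = solve-∀ ring
    eq₂ : ∀ p q e → e - (- (p - q)) ≡ (p + e) - q
    eq₂ = solve-∀ ring

  ≈⇒∣-∣≤ : ∀ {p q e} → p ≈[ e ] q → ∣ p - q ∣ ≤ e
  ≈⇒∣-∣≤ {p} {q} {e} (within u l) with ℚ.∣p∣≡p∨∣p∣≡-p (p - q)
  ... | inj₁ eq rewrite eq = ≤-by (p≤q⇒0≤q-p u) (eq₁ p q e)
    where
    eq₁ : ∀ p q e → (q + e) - p ≡ e - (p - q)
    eq₁ = solve-∀ ring
  ... | inj₂ eq rewrite eq = ≤-by (p≤q⇒0≤q-p l) (eq₂ p q e)
    where
    eq₂ : ∀ p q e → (p + e) - q ≡ e - (- (p - q))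
    eq₂ = solve-∀ ring

  -- Natural numbers as rationals

  toℚᵘ-/1 : ∀ z → toℚᵘ (z / 1) ℚᵘ.≃ ℚᵘ.mkℚᵘ z 0
  toℚᵘ-/1 z = ℚ.toℚᵘ-fromℚᵘ (ℚᵘ.mkℚᵘ z 0)

  /1-mono : ∀ {y z} → y ℤ.≤ z → y / 1 ≤ z / 1
  /1-mono {y} {z} y≤z = ℚ.toℚᵘ-cancel-≤
    (ℚᵘ.≤-respˡ-≃ (ℚᵘ.≃-sym (toℚᵘ-/1 y)) (ℚᵘ.≤-respʳ-≃ (ℚᵘ.≃-sym (toℚᵘ-/1 z))
      (ℚᵘ.*≤* (subst₂ ℤ._≤_ (sym (ℤ.*-identityʳ y)) (sym (ℤ.*-identityʳ z)) y≤z))))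

  opaque
    -- Opaque, so that conversion checking keeps `ι n` as an atom and does not normalise the
    -- fraction.
    ι : ℕ → ℚ
    ι n = + n / 1

  opaque
    unfolding ι

    ι≡/1 : ∀ n → ι n ≡ + n / 1
    ι≡/1 n = refl

    ι0 : ι 0 ≡ 0ℚ
    ι0 = refl

    ι1 : ι 1 ≡ 1ℚ
    ι1 = refl

    ι12*1/12 : ι 12 * (+ 1 / 12) ≡ 1ℚ
    ι12*1/12 = refl

    ι-mono : ∀ {m n} → m ℕ.≤ n → ι m ≤ ι n
    ι-mono m≤n = /1-mono (ℤ.+≤+ m≤n)

    ι-suc : ∀ n → ι (suc n) ≡ ι n + 1ℚ
    ι-suc n = ℚ.toℚᵘ-injective (ℚᵘ.≃-trans (toℚᵘ-/1 (+ suc n))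
      (ℚᵘ.≃-trans (ℚᵘ.*≡* eq)
        (ℚᵘ.≃-sym (ℚᵘ.≃-trans (ℚ.toℚᵘ-homo-+ (ι n) 1ℚ) (ℚᵘ.+-congˡ ℚᵘ.1ℚᵘ (toℚᵘ-/1 (+ n)))))))
      where
      eq : + suc n ℤ.* + 1 ≡ (+ n ℤ.* + 1 ℤ.+ + 1) ℤ.* + 1
      eq = cong (ℤ._* + 1) (trans (cong +_ (ℕ.+-comm 1 n))
        (cong (ℤ._+ + 1) (sym (ℤ.*-identityʳ (+ n)))))

    m/n*n : ∀ m n .{{_ : ℕ.NonZero n}} → (+ m / n) * ι n ≡ ι m
    m/n*n m n@(suc n-1) = ℚ.toℚᵘ-injective (ℚᵘ.≃-trans (ℚ.toℚᵘ-homo-* (+ m / n) (ι n))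
      (ℚᵘ.≃-trans (ℚᵘ.*-cong (ℚ.toℚᵘ-fromℚᵘ (ℚᵘ.mkℚᵘ (+ m) n-1)) (toℚᵘ-/1 (+ n)))
      (ℚᵘ.≃-trans (ℚᵘ.*≡* {q = ℚᵘ.mkℚᵘ (+ m) 0} (ℤ.*-assoc (+ m) (+ n) (+ 1)))
        (ℚᵘ.≃-sym (toℚᵘ-/1 (+ m))))))

    ≤ι : ∀ p → ∃ λ n → p ≤ ι n
    ≤ι p@record{} = ℤ.∣ ↥ p ∣ , ℚ.toℚᵘ-cancel-≤ (ℚᵘ.≤-respʳ-≃ (ℚᵘ.≃-sym (toℚᵘ-/1 (+ ℤ.∣ ↥ p ∣)))
      (ℚᵘ.*≤* (subst (ℤ._≤ + ℤ.∣ ↥ p ∣ ℤ.* ↧ p) (sym (ℤ.*-identityʳ (↥ p)))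
        (ℤ.≤-trans (z≤∣z∣ (↥ p)) (subst (+ ℤ.∣ ↥ p ∣ ℤ.≤_) (ℤ.pos-* ℤ.∣ ↥ p ∣ (↧ₙ p))
           (ℤ.+≤+ (ℕ.m≤m*n ℤ.∣ ↥ p ∣ (↧ₙ p))))))))
      where
      z≤∣z∣ : ∀ z → z ℤ.≤ + ℤ.∣ z ∣
      z≤∣z∣ (+ n) = ℤ.≤-refl
      z≤∣z∣ ℤ.-[1+ n ] = ℤ.-≤+

  0≤ι : ∀ n → 0ℚ ≤ ι n
  0≤ι n = subst (_≤ ι n) ι0 (ι-mono ℕ.z≤n)

  1≤ι : ∀ n → 1ℚ ≤ ι (suc n)
  1≤ι n = subst (_≤ ι (suc n)) ι1 (ι-mono (ℕ.s≤s ℕ.z≤n))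

  archimedean : ∀ p {η} → 0ℚ < η → ∃ λ N → ∀ n → N ℕ.≤ n → p ≤ ι n * η
  archimedean p {η} 0<η = proj₁ (≤ι (p * η⁻¹)) , λ n N≤n →
    subst (_≤ ι n * η) (trans (ℚ.*-assoc p η⁻¹ η) (trans (cong (p *_) (ℚ.*-inverseˡ η)) (ℚ.*-identityʳ p)))
      (*-monoʳ (ℚ.<⇒≤ 0<η) (ℚ.≤-trans (proj₂ (≤ι (p * η⁻¹))) (ι-mono N≤n)))
    where
    instance
      _ : NonZero η
      _ = ℚ.pos⇒nonZero η {{positive 0<η}}
    η⁻¹ : ℚ
    η⁻¹ = 1/ η

  -- The value at 0 is junk.
  opaque
    inv : ℚ → ℚ
    inv p with p ℚ.≟ 0ℚ
    ... | yes _   = 0ℚ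
    ... | no  p≢0 = 1/_ p {{≢-nonZero p≢0}}

  private
    1≤p⇒p≢0 : ∀ {p} → 1ℚ ≤ p → ¬ p ≡ 0ℚ
    1≤p⇒p≢0 1≤p refl = ℚ.<-irrefl refl (ℚ.<-≤-trans 0<1 1≤p)

  opaque
    unfolding inv ι

    *-inv : ∀ {p} → 1ℚ ≤ p → p * inv p ≡ 1ℚ
    *-inv {p} 1≤p with p ℚ.≟ 0ℚ
    ... | yes p≡0 = contradiction p≡0 (1≤p⇒p≢0 1≤p)
    ... | no  p≢0 = ℚ.*-inverseʳ p {{≢-nonZero p≢0}}

    0<inv : ∀ {p} → 1ℚ ≤ p → 0ℚ < inv p
    0<inv {p} 1≤p with p ℚ.≟ 0ℚ
    ... | yes p≡0 = contradiction p≡0 (1≤p⇒p≢0 1≤p)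
    ... | no  p≢0 = ℚ.positive⁻¹ (1/_ p {{≢-nonZero p≢0}})
      {{ℚ.1/pos⇒pos p {{positive (ℚ.<-≤-trans 0<1 1≤p)}}}}

    inv1 : inv 1ℚ ≡ 1ℚ
    inv1 = refl

    inv2*inv3*inv2 : inv (ι 2) * inv (ι 3) * inv (ι 2) ≡ + 1 / 12
    inv2*inv3*inv2 = refl

  0≤inv : ∀ {p} → 1ℚ ≤ p → 0ℚ ≤ inv p
  0≤inv 1≤p = ℚ.<⇒≤ (0<inv 1≤p)

  -- Each reciprocal is multiplied by the other number times its reciprocal, which is 1.
  -- Monotonicity of the weights and both bounds on the slope of the sums rest on this identity.
  inv-difference : ∀ {p q} → 1ℚ ≤ p → 1ℚ ≤ q → inv p - inv q ≡ (q - p) * (inv p * inv q)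
  inv-difference {p} {q} 1≤p 1≤q = trans
    (cong₂ _-_ (trans (sym (ℚ.*-identityˡ (inv p))) (cong (_* inv p) (sym (*-inv 1≤q))))
               (trans (sym (ℚ.*-identityˡ (inv q))) (cong (_* inv q) (sym (*-inv 1≤p)))))
    (eq p q (inv p) (inv q))
    where
    eq : ∀ p q p′ q′ → q * q′ * p′ - p * p′ * q′ ≡ (q - p) * (p′ * q′)
    eq = solve-∀ ring

  inv-antimono : ∀ {p q} → 1ℚ ≤ p → p ≤ q → inv q ≤ inv p
  inv-antimono 1≤p p≤q = ≤-by
    (0≤* (p≤q⇒0≤q-p p≤q) (0≤* (0≤inv 1≤p) (0≤inv 1≤q))) (sym (inv-difference 1≤p 1≤q))
    where 1≤q = ℚ.≤-trans 1≤p p≤q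

  inv≤1 : ∀ {p} → 1ℚ ≤ p → inv p ≤ 1ℚ
  inv≤1 {p} 1≤p = subst (inv p ≤_) inv1 (inv-antimono ℚ.≤-refl 1≤p)

  inv-small : ∀ {η} → 0ℚ < η → ∃ λ N → ∀ n → N ℕ.≤ n → inv (ι (suc n)) ≤ η
  inv-small {η} 0<η with archimedean 1ℚ 0<η
  ... | N , h = N , λ n N≤n → *-cancelʳ-≤ (1≤ι n)
    (subst (_≤ η * ι (suc n)) (trans (sym (*-inv (1≤ι n))) (ℚ.*-comm (ι (suc n)) (inv (ι (suc n)))))
      (subst (1ℚ ≤_) (ℚ.*-comm (ι (suc n)) η) (h (suc n) (ℕ.m≤n⇒m≤1+n N≤n))))

  -- Alternating sums

  -- The sum `f 0 - f 1 + f 2 - …` of `m` terms. Peeling off the head turns the signs into one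
  -- subtraction, so that induction passes to the shifted sequence.
  alt : (ℕ → ℚ) → ℕ → ℚ
  alt f zero    = 0ℚ
  alt f (suc m) = f 0 - alt (f ∘ suc) m

  record Decreasing (f : ℕ → ℚ) : Set where
    constructor decreasing
    field
      nonneg   : ∀ i → 0ℚ ≤ f i
      antitone : ∀ i → f (suc i) ≤ f i

  open Decreasing public

  tail : ∀ {f} → Decreasing f → Decreasing (f ∘ suc)
  tail (decreasing n a) = decreasing (n ∘ suc) (a ∘ suc)

  p-q≤p : ∀ p {q} → 0ℚ ≤ q → p - q ≤ p
  p-q≤p p {q} 0≤q = ≤-by 0≤q (eq p q)
    where
    eq : ∀ p q → q ≡ p - (p - q)
    eq = solve-∀ ring

  mutual
    -- Leibniz's estimate. The two bounds are proved together, since subtracting the tail exchanges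
    -- its upper and lower bounds.
    0≤alt : ∀ {f} → Decreasing f → ∀ m → 0ℚ ≤ alt f m
    0≤alt d zero    = ℚ.≤-refl
    0≤alt d (suc m) = p≤q⇒0≤q-p (ℚ.≤-trans (alt≤head (tail d) m) (antitone d 0))

    alt≤head : ∀ {f} → Decreasing f → ∀ m → alt f m ≤ f 0
    alt≤head     d zero    = nonneg d 0
    alt≤head {f} d (suc m) = p-q≤p (f 0) (0≤alt (tail d) m)

  head-next≤alt : ∀ {f} → Decreasing f → ∀ m → f 0 - f 1 ≤ alt f (suc m)
  head-next≤alt {f} d m = ℚ.+-monoʳ-≤ (f 0) (ℚ.neg-antimono-≤ (alt≤head (tail d) m))

  alt-cong : ∀ {f g} → (∀ i → f i ≡ g i) → ∀ m → alt f m ≡ alt g m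
  alt-cong f≡g zero    = refl
  alt-cong f≡g (suc m) = cong₂ _-_ (f≡g 0) (alt-cong (f≡g ∘ suc) m)

  alt-zero : ∀ m → alt (λ _ → 0ℚ) m ≡ 0ℚ
  alt-zero zero    = refl
  alt-zero (suc m) = cong (λ x → 0ℚ - x) (alt-zero m)

  alt-add : ∀ f g m → alt (λ i → f i + g i) m ≡ alt f m + alt g m
  alt-add f g zero    = refl
  alt-add f g (suc m) = trans (cong (λ x → f 0 + g 0 - x) (alt-add (f ∘ suc) (g ∘ suc) m))
    (eq (f 0) (g 0) (alt (f ∘ suc) m) (alt (g ∘ suc) m))
    where
    eq : ∀ p q r s → p + q - (r + s) ≡ (p - r) + (q - s)
    eq = solve-∀ ring

  alt-scale : ∀ c f m → alt (λ i → c * f i) m ≡ c * alt f m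
  alt-scale c f zero    = sym (ℚ.*-zeroʳ c)
  alt-scale c f (suc m) = trans (cong (λ x → c * f 0 - x) (alt-scale c (f ∘ suc) m))
    (eq c (f 0) (alt (f ∘ suc) m))
    where
    eq : ∀ c p q → c * p - c * q ≡ c * (p - q)
    eq = solve-∀ ring

  alt-≈ : ∀ {f g e} → (∀ i → f i ≈[ e ] g i) → ∀ m → alt f m ≈[ ι m * e ] alt g m
  alt-≈ {e = e} f≈g zero    = subst (λ e → 0ℚ ≈[ e ] 0ℚ) (sym (trans (cong (_* e) ι0) (ℚ.*-zeroˡ e))) ≈-refl
  alt-≈ {f} {g} {e} f≈g (suc m) = subst (λ d → alt f (suc m) ≈[ d ] alt g (suc m))
    (trans (eq (ι m) e) (cong (_* e) (sym (ι-suc m))))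
    (≈-subtract (f≈g 0) (alt-≈ (f≈g ∘ suc) m))
    where
    eq : ∀ x e → e + x * e ≡ (x + 1ℚ) * e
    eq = solve-∀ ring

  -- Up to sign, the omitted terms form an alternating sum with head `f m`.
  alt-tail : ∀ {f} → Decreasing f → ∀ m l → alt f (m ℕ.+ l) ≈[ f m ] alt f m
  alt-tail {f} d zero l = within
    (subst (alt f l ≤_) (sym (ℚ.+-identityˡ (f 0))) (alt≤head d l))
    (0≤+ (0≤alt d l) (nonneg d 0))
  alt-tail {f} d (suc m) l = subst (λ e → alt f (suc m ℕ.+ l) ≈[ e ] alt f (suc m))
    (ℚ.+-identityˡ (f (suc m))) (≈-subtract (≈-refl {f 0}) (alt-tail (tail d) m l))

  -- The limiting density of the odd terms at the shift a is the alternating sum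
  -- of the reciprocals of 1, 2 - a, 3 - a, …
  denominator : ℚ → ℕ → ℚ
  denominator a zero    = 1ℚ
  denominator a (suc i) = ι (suc (suc i)) - a

  weight : ℚ → ℕ → ℚ
  weight a zero    = 1ℚ
  weight a (suc i) = inv (denominator a (suc i))

  oddPart : ℚ → ℕ → ℚ
  oddPart a = alt (weight a)

  record Unit (a : ℚ) : Set where
    constructor unit
    field
      0≤ : 0ℚ ≤ a
      ≤1 : a ≤ 1ℚ

  open Unit public

  1≤denominator : ∀ {a} → Unit a → ∀ i → 1ℚ ≤ denominator a i
  1≤denominator     u zero    = ℚ.≤-refl
  1≤denominator {a} u (suc i) = ≤-by (0≤+ (p≤q⇒0≤q-p (≤1 u)) (0≤ι i))
    (trans (eq a (ι i)) (cong (λ x → x - a - 1ℚ) (sym (trans (ι-suc (suc i)) (cong (_+ 1ℚ) (ι-suc i))))))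
    where
    eq : ∀ a x → (1ℚ - a) + x ≡ (x + 1ℚ + 1ℚ) - a - 1ℚ
    eq = solve-∀ ring

  denominator-suc : ∀ a i → denominator a (suc (suc i)) - denominator a (suc i) ≡ 1ℚ
  denominator-suc a i = trans (cong (λ x → x - a - (ι (suc (suc i)) - a)) (ι-suc (suc (suc i))))
    (eq (ι (suc (suc i))) a)
    where
    eq : ∀ x a → (x + 1ℚ - a) - (x - a) ≡ 1ℚ
    eq = solve-∀ ring

  denominator*weight : ∀ {a} → Unit a → ∀ i → denominator a i * weight a i ≡ 1ℚ
  denominator*weight u zero    = refl
  denominator*weight u (suc i) = *-inv (1≤denominator u (suc i))

  weight-decreasing : ∀ {a} → Unit a → Decreasing (weight a)
  weight-decreasing {a} u = decreasing nonneg′ anti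
    where
    nonneg′ : ∀ i → 0ℚ ≤ weight a i
    nonneg′ zero    = 0≤1
    nonneg′ (suc i) = 0≤inv (1≤denominator u (suc i))
    anti : ∀ i → weight a (suc i) ≤ weight a i
    anti zero    = inv≤1 (1≤denominator u 1)
    anti (suc i) = inv-antimono (1≤denominator u (suc i))
      (≤-by 0≤1 (sym (denominator-suc a i)))

  weight≤inv : ∀ {a} → Unit a → ∀ i → weight a (suc i) ≤ inv (ι (suc i))
  weight≤inv {a} u i = inv-antimono (1≤ι i)
    (≤-by (p≤q⇒0≤q-p (≤1 u)) (trans (eq a (ι (suc i)))
       (cong (λ x → x - a - ι (suc i)) (sym (ι-suc (suc i))))))
    where
    eq : ∀ a x → 1ℚ - a ≡ (x + 1ℚ - a) - x
    eq = solve-∀ ring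

  oddPart-tail : ∀ {a} → Unit a → ∀ {m n} → m ℕ.≤ n → oddPart a n ≈[ weight a m ] oddPart a m
  oddPart-tail {a} u {m} {n} m≤n = subst (λ k → oddPart a k ≈[ weight a m ] oddPart a m)
    (ℕ.m+[n∸m]≡n m≤n) (alt-tail (weight-decreasing u) m (n ℕ.∸ m))

  -- Dependence of the partial sums on the shift

  module _ {a b : ℚ} (ua : Unit a) (ub : Unit b) (a≤b : a ≤ b) where

    private
      product : ℕ → ℚ
      product i = weight b (suc i) * weight a (suc i)

      da = tail (weight-decreasing ua)
      db = tail (weight-decreasing ub)

      product-decreasing : Decreasing product
      product-decreasing = decreasing (λ i → 0≤* (nonneg db i) (nonneg da i))
        λ i → *-mono (nonneg db (suc i)) (nonneg da (suc i)) (antitone db i) (antitone da i)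

      difference : ∀ i → weight b (suc i) ≡ (b - a) * product i + weight a (suc i)
      difference i = trans (eq (weight b (suc i)) (weight a (suc i)))
        (cong (_+ weight a (suc i)) (trans
          (inv-difference (1≤denominator ub (suc i)) (1≤denominator ua (suc i)))
          (cong (_* product i) (eq′ (ι (suc (suc i))) a b))))
        where
        eq : ∀ p q → p ≡ (p - q) + q
        eq = solve-∀ ring
        eq′ : ∀ x a b → (x - a) - (x - b) ≡ b - a
        eq′ = solve-∀ ring

      -- The leading terms 1 cancel. All later denominators at `a` exceed those at `b` by the same
      -- `b - a`, which factors out and leaves an alternating sum of decreasing products.
      oddPart-difference : ∀ m → oddPart a (suc m) - oddPart b (suc m) ≡ (b - a) * alt product m
      oddPart-difference m = trans
        (cong (λ x → oddPart a (suc m) - (1ℚ - x)) (trans (alt-cong difference m)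
          (trans (alt-add _ (weight a ∘ suc) m)
            (cong (_+ alt (weight a ∘ suc) m) (alt-scale (b - a) product m)))))
        (eq (alt (weight a ∘ suc) m) ((b - a) * alt product m))
        where
        eq : ∀ x y → 1ℚ - x - (1ℚ - (y + x)) ≡ y
        eq = solve-∀ ring

      weight≥ : ∀ {x} → Unit x → ∀ i → inv (ι (suc (suc i))) ≤ weight x (suc i)
      weight≥ {x} u i = inv-antimono (1≤denominator u (suc i)) (p-q≤p _ (0≤ u))

      -- The difference is at least `(weight b 1 - weight b 2) * weight a 1`. Consecutive
      -- denominators differ by 1, so the bracket equals `weight b 1 * weight b 2`, and the three
      -- factors are at least 1/2, 1/3 and 1/2.
      twelfth≤ : + 1 / 12 ≤ product 0 - product 1
      twelfth≤ = ℚ.≤-trans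
        (subst (_≤ weight b 1 * weight b 2 * weight a 1) inv2*inv3*inv2 (*-mono
          (0≤* (0≤inv (1≤ι 1)) (0≤inv (1≤ι 2))) (0≤inv (1≤ι 1))
          (*-mono (0≤inv (1≤ι 1)) (0≤inv (1≤ι 2)) (weight≥ ub 0) (weight≥ ub 1)) (weight≥ ua 0)))
        (≤-by (0≤* (nonneg db 1) (p≤q⇒0≤q-p (antitone da 0)))
          (trans (eq (weight b 1) (weight b 2) (weight a 1) (weight a 2))
            (cong (λ x → product 0 - product 1 - x * weight a 1) step)))
        where
        step : weight b 1 - weight b 2 ≡ weight b 1 * weight b 2
        step = trans (inv-difference (1≤denominator ub 1) (1≤denominator ub 2))
          (trans (cong (_* (weight b 1 * weight b 2)) (denominator-suc b 0)) (ℚ.*-identityˡ _))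
        eq : ∀ p p′ q q′ → p′ * (q - q′) ≡ p * q - p′ * q′ - (p - p′) * q
        eq = solve-∀ ring

    oddPart-antitone : ∀ m → oddPart b (suc m) ≤ oddPart a (suc m)
    oddPart-antitone m = ≤-by (0≤* (p≤q⇒0≤q-p a≤b) (0≤alt product-decreasing m))
      (sym (oddPart-difference m))

    oddPart-lipschitz : ∀ m → oddPart a (suc m) - oddPart b (suc m) ≤ b - a
    oddPart-lipschitz m = subst₂ _≤_ (sym (oddPart-difference m)) (ℚ.*-identityʳ (b - a))
      (*-monoˡ (p≤q⇒0≤q-p a≤b) (ℚ.≤-trans (alt≤head product-decreasing m)
        (*-mono (nonneg db 0) (nonneg da 0) (inv≤1 (1≤denominator ub 1)) (inv≤1 (1≤denominator ua 1)))))

    -- With `2 + m` terms at least one product is present, as `head-next≤alt` requires.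
    oddPart-steep : ∀ m → b - a ≤ ι 12 * (oddPart a (2 ℕ.+ m) - oddPart b (2 ℕ.+ m))
    oddPart-steep m = subst₂ _≤_ (trans (eq (ι 12) (+ 1 / 12) (b - a))
        (trans (cong (_* (b - a)) ι12*1/12) (ℚ.*-identityˡ (b - a))))
      (cong (ι 12 *_) (sym (oddPart-difference (suc m))))
      (*-monoˡ (0≤ι 12) (*-monoˡ (p≤q⇒0≤q-p a≤b) (ℚ.≤-trans twelfth≤ (head-next≤alt product-decreasing m))))
      where
      eq : ∀ c d x → c * (x * d) ≡ c * d * x
      eq = solve-∀ ring

    oddPart-≈-ordered : ∀ {e} → a ≈[ e ] b → ∀ m → oddPart a (suc m) ≈[ e ] oddPart b (suc m)
    oddPart-≈-ordered {e} a≈b m = within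
      (≤-by (0≤+ (p≤q⇒0≤q-p (oddPart-lipschitz m)) (p≤q⇒0≤q-p (lower a≈b)))
        (eq₁ a b e (oddPart a (suc m)) (oddPart b (suc m))))
      (≤-by (0≤+ (p≤q⇒0≤q-p (oddPart-antitone m)) (0≤+ (p≤q⇒0≤q-p a≤b) (p≤q⇒0≤q-p (lower a≈b))))
        (eq₂ a b e (oddPart a (suc m)) (oddPart b (suc m))))
      where
      eq₁ : ∀ a b e x y → (b - a - (x - y)) + (a + e - b) ≡ y + e - x
      eq₁ = solve-∀ ring
      eq₂ : ∀ a b e x y → (x - y) + ((b - a) + (a + e - b)) ≡ x + e - y
      eq₂ = solve-∀ ring

    oddPart-≈⁻¹-ordered : ∀ {e} m → oddPart a (2 ℕ.+ m) ≈[ e ] oddPart b (2 ℕ.+ m) →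
      a ≈[ ι 12 * e ] b
    oddPart-≈⁻¹-ordered {e} m S≈ = within
      (≤-by (0≤+ (p≤q⇒0≤q-p a≤b) (0≤+ (p≤q⇒0≤q-p a≤b) (p≤q⇒0≤q-p b-a≤12e))) (eq₁ a b (ι 12 * e)))
      (≤-by (p≤q⇒0≤q-p b-a≤12e) (eq₂ a b (ι 12 * e)))
      where
      x = oddPart a (2 ℕ.+ m)
      y = oddPart b (2 ℕ.+ m)
      eq₀ : ∀ x y e → y + e - x ≡ e - (x - y)
      eq₀ = solve-∀ ring
      eq₁ : ∀ a b e → (b - a) + ((b - a) + (e - (b - a))) ≡ b + e - a
      eq₁ = solve-∀ ring
      eq₂ : ∀ a b e → e - (b - a) ≡ a + e - b
      eq₂ = solve-∀ ring
      b-a≤12e : b - a ≤ ι 12 * e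
      b-a≤12e = ℚ.≤-trans (oddPart-steep m)
        (*-monoˡ (0≤ι 12) (≤-by {x - y} {e} (p≤q⇒0≤q-p (upper S≈)) (eq₀ x y e)))

  oddPart-≈ : ∀ {a b e} → Unit a → Unit b → a ≈[ e ] b →
    ∀ m → oddPart a (suc m) ≈[ e ] oddPart b (suc m)
  oddPart-≈ {a} {b} ua ub a≈b m with ℚ.≤-total a b
  ... | inj₁ a≤b = oddPart-≈-ordered ua ub a≤b a≈b m
  ... | inj₂ b≤a = ≈-sym (oddPart-≈-ordered ub ua b≤a (≈-sym a≈b) m)

  -- Inverse continuity, with the constant of `oddPart-steep`. It yields both the convergence of the
  -- approximate roots and the uniqueness of the shift.
  oddPart-≈⁻¹ : ∀ {a b e} → Unit a → Unit b → ∀ m →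
    oddPart a (2 ℕ.+ m) ≈[ e ] oddPart b (2 ℕ.+ m) → a ≈[ ι 12 * e ] b
  oddPart-≈⁻¹ {a} {b} ua ub m S≈ with ℚ.≤-total a b
  ... | inj₁ a≤b = oddPart-≈⁻¹-ordered ua ub a≤b m S≈
  ... | inj₂ b≤a = ≈-sym (oddPart-≈⁻¹-ordered ub ua b≤a m (≈-sym S≈))

  -- The shift with limiting density one half

  opaque
    unfolding inv ι

    weight0-1 : weight 0ℚ 1 ≡ ½
    weight0-1 = refl

    weight1-1 : weight 1ℚ 1 ≡ 1ℚ
    weight1-1 = refl

    weight1-2 : weight 1ℚ 2 ≡ ½
    weight1-2 = refl

  0-unit : Unit 0ℚ
  0-unit = unit ℚ.≤-refl 0≤1

  1-unit : Unit 1ℚ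
  1-unit = unit 0≤1 ℚ.≤-refl

  -- What is subtracted from the leading 1 is at most its own head, 1/2.
  ½≤oddPart0 : ∀ m → ½ ≤ oddPart 0ℚ (2 ℕ.+ m)
  ½≤oddPart0 m = ℚ.+-monoʳ-≤ 1ℚ (ℚ.neg-antimono-≤
    (subst (alt (weight 0ℚ ∘ suc) (suc m) ≤_) weight0-1
      (alt≤head (tail (weight-decreasing 0-unit)) (suc m))))

  -- At the shift 1 the first two terms are both 1 and cancel; the rest is an alternating sum with
  -- head 1/2.
  oddPart1≤½ : ∀ m → oddPart 1ℚ (2 ℕ.+ m) ≤ ½
  oddPart1≤½ m = subst₂ _≤_
    (trans (eq rest) (cong (λ x → 1ℚ - (x - rest)) (sym weight1-1))) weight1-2
    (alt≤head (tail (tail (weight-decreasing 1-unit))) m)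
    where
    rest = alt (λ i → weight 1ℚ (suc (suc i))) m
    eq : ∀ x → x ≡ 1ℚ - (1ℚ - x)
    eq = solve-∀ ring

  -- Discrete intermediate value theorem. The search descends from the top, deciding each comparison
  -- by the total order of ℚ.
  crossing : ∀ (f : ℕ → ℚ) c n → c ≤ f 0 → f (suc n) ≤ c →
    ∃ λ m → m ℕ.≤ n × c ≤ f m × f (suc m) ≤ c
  crossing f c zero    c≤f0 f1≤c = 0 , ℕ.z≤n , c≤f0 , f1≤c
  crossing f c (suc n) c≤f0 f≤c with ℚ.≤-total c (f (suc n))
  ... | inj₁ c≤f = suc n , ℕ.≤-refl , c≤f , f≤c
  ... | inj₂ f≤c′ with crossing f c n c≤f0 f≤c′
  ...   | m , m≤n , c≤fm , fm≤c = m , ℕ.m≤n⇒m≤1+n m≤n , c≤fm , fm≤c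

  -- At a crossing, `f m` is at least `c` and exceeds the next value, itself at most `c`, by at most
  -- `e`.
  crossing-≈ : ∀ (f : ℕ → ℚ) {c e} n → 0ℚ ≤ e → c ≤ f 0 → f (suc n) ≤ c →
    (∀ m → m ℕ.≤ n → f m - f (suc m) ≤ e) → ∃ λ m → m ℕ.≤ n × f m ≈[ e ] c
  crossing-≈ f {c} {e} n 0≤e c≤f0 f≤c step with crossing f c n c≤f0 f≤c
  ... | m , m≤n , c≤fm , fm≤c = m , m≤n , within
    (≤-by (0≤+ (p≤q⇒0≤q-p (step m m≤n)) (p≤q⇒0≤q-p fm≤c)) (eq c (f m) (f (suc m)) e))
    (ℚ.≤-trans c≤fm (subst (_≤ f m + e) (ℚ.+-identityʳ (f m)) (ℚ.+-monoʳ-≤ (f m) 0≤e)))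
    where
    eq : ∀ c x y e → (e - (x - y)) + (c - y) ≡ (c + e) - x
    eq = solve-∀ ring

  -- Grids and approximate roots

  mesh : ℕ → ℚ
  mesh j = inv (ι (suc j))

  mesh-antitone : ∀ {j k} → j ℕ.≤ k → mesh k ≤ mesh j
  mesh-antitone {j} j≤k = inv-antimono (1≤ι j) (ι-mono (ℕ.s≤s j≤k))

  grid : ℕ → ℕ → ℚ
  grid j m = ι m * mesh j

  grid0 : ∀ j → grid j 0 ≡ 0ℚ
  grid0 j = trans (cong (_* mesh j) ι0) (ℚ.*-zeroˡ (mesh j))

  grid1 : ∀ j → grid j (suc j) ≡ 1ℚ
  grid1 j = *-inv (1≤ι j)

  grid-unit : ∀ {j m} → m ℕ.≤ suc j → Unit (grid j m)
  grid-unit {j} {m} m≤ = unit (0≤* (0≤ι m) (0≤inv (1≤ι j)))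
    (subst (grid j m ≤_) (grid1 j) (*-monoʳ (0≤inv (1≤ι j)) (ι-mono m≤)))

  -- The Lipschitz constant 1 bounds the change over one grid step by the mesh. With `2 + j` terms
  -- the truncation error is at most the mesh as well.
  halving-index : ∀ j → ∃ λ m → m ℕ.≤ j × oddPart (grid j m) (2 ℕ.+ j) ≈[ mesh j ] ½
  halving-index j = crossing-≈ (λ m → oddPart (grid j m) (2 ℕ.+ j)) j (0≤inv (1≤ι j))
    (subst (λ a → ½ ≤ oddPart a (2 ℕ.+ j)) (sym (grid0 j)) (½≤oddPart0 j))
    (subst (λ a → oddPart a (2 ℕ.+ j) ≤ ½) (sym (grid1 j)) (oddPart1≤½ j))
    (λ m m≤j → subst (oddPart (grid j m) (2 ℕ.+ j) - oddPart (grid j (suc m)) (2 ℕ.+ j) ≤_) (step m)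
      (oddPart-lipschitz (grid-unit {j} {m} (ℕ.m≤n⇒m≤1+n m≤j)) (grid-unit {j} {suc m} (ℕ.s≤s m≤j))
        (*-monoʳ (0≤inv (1≤ι j)) (ι-mono (ℕ.n≤1+n m))) (suc j)))
    where
    eq : ∀ p e → (p + 1ℚ) * e - p * e ≡ e
    eq = solve-∀ ring
    step : ∀ m → grid j (suc m) - grid j m ≡ mesh j
    step m = trans (cong (λ z → z * mesh j - grid j m) (ι-suc m)) (eq (ι m) (mesh j))

  opaque
    -- Opaque, so that conversion checking does not run the search.
    root : ℕ → ℚ
    root j = grid j (proj₁ (halving-index j))

    root-unit : ∀ j → Unit (root j)
    root-unit j = grid-unit {j} (ℕ.m≤n⇒m≤1+n (proj₁ (proj₂ (halving-index j))))

    root-halves : ∀ j → oddPart (root j) (2 ℕ.+ j) ≈[ mesh j ] ½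
    root-halves j = proj₂ (proj₂ (halving-index j))

  weight≤mesh : ∀ {a} → Unit a → ∀ j → weight a (2 ℕ.+ j) ≤ mesh j
  weight≤mesh u j = ℚ.≤-trans (weight≤inv u (suc j)) (mesh-antitone (ℕ.n≤1+n j))

  -- One `mesh j` pays for cutting the sum from `2 + k` to `2 + j` terms, the other for the error
  -- `mesh k` of `root k`.
  oddPart-root : ∀ {j k} → j ℕ.≤ k → oddPart (root k) (2 ℕ.+ j) ≈[ mesh j + mesh j ] ½
  oddPart-root {j} {k} j≤k = ≈-trans
    (≈-weaken (weight≤mesh (root-unit k) j)
      (≈-sym (oddPart-tail (root-unit k) (ℕ.s≤s (ℕ.s≤s j≤k)))))
    (≈-weaken (mesh-antitone j≤k) (root-halves k))

  -- Both roots are compared at the coarser truncation `2 + j`, where their sums are within one and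
  -- two meshes of 1/2.
  root-≈ : ∀ {j k} → j ℕ.≤ k → root j ≈[ ι 12 * (mesh j + (mesh j + mesh j)) ] root k
  root-≈ {j} {k} j≤k = oddPart-≈⁻¹ (root-unit j) (root-unit k) j
    (≈-trans (root-halves j) (≈-sym (oddPart-root j≤k)))

  -- Sums over 0, …, n - 1

  bit : Bool → ℚ
  bit true  = 1ℚ
  bit false = 0ℚ

  0≤bit : ∀ b → 0ℚ ≤ bit b
  0≤bit true  = 0≤1
  0≤bit false = ℚ.≤-refl

  bit≤1 : ∀ b → bit b ≤ 1ℚ
  bit≤1 true  = ℚ.≤-refl
  bit≤1 false = 0≤1

  total : (ℕ → ℚ) → ℕ → ℚ
  total f zero    = 0ℚ
  total f (suc n) = total f n + f n

  total-≈ : ∀ {f g e} → (∀ k → f k ≈[ e k ] g k) → ∀ n → total f n ≈[ total e n ] total g n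
  total-≈ f≈g zero    = ≈-refl
  total-≈ f≈g (suc n) = ≈-add (total-≈ f≈g n) (f≈g n)

  total-cong : ∀ {f g} n → (∀ k → k ℕ.< n → f k ≡ g k) → total f n ≡ total g n
  total-cong zero    f≡g = refl
  total-cong (suc n) f≡g =
    cong₂ _+_ (total-cong n λ k k<n → f≡g k (ℕ.m≤n⇒m≤1+n k<n)) (f≡g n ℕ.≤-refl)

  total-alt : ∀ (f : ℕ → ℕ → ℚ) m n →
    total (λ k → alt (λ i → f i k) m) n ≡ alt (λ i → total (f i) n) m
  total-alt f m zero    = sym (alt-zero m)
  total-alt f m (suc n) = trans (cong (_+ alt (λ i → f i n) m) (total-alt f m n))
    (sym (alt-add (λ i → total (f i) n) (λ i → f i n) m))

  total-complement : ∀ f n → total (λ k → 1ℚ - f k) n ≡ ι n - total f n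
  total-complement f zero    = cong (_- 0ℚ) (sym ι0)
  total-complement f (suc n) = trans (cong (_+ (1ℚ - f n)) (total-complement f n))
    (trans (eq (ι n) (total f n) (f n)) (cong (_- total f (suc n)) (sym (ι-suc n))))
    where
    eq : ∀ x y z → (x - y) + (1ℚ - z) ≡ (x + 1ℚ) - (y + z)
    eq = solve-∀ ring

  total-bit≤ : ∀ b n → total (bit ∘ b) n ≤ ι n
  total-bit≤ b zero    = 0≤ι 0
  total-bit≤ b (suc n) =
    subst (total (bit ∘ b) (suc n) ≤_) (sym (ι-suc n)) (ℚ.+-mono-≤ (total-bit≤ b n) (bit≤1 (b n)))

  length-filter-upTo : ∀ {P : ℕ → Set} (P? : Decidable P) n →
    ι (length (filter P? (upTo n))) ≡ total (λ k → bit (does (P? k))) n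
  length-filter-upTo P? zero    = ι0
  length-filter-upTo P? (suc n) = trans
    (cong ι (trans (cong (length ∘ filter P?) (sym (List.upTo-∷ʳ n)))
      (trans (cong length (List.filter-++ P? (upTo n) (n ∷ [])))
             (List.length-++ (filter P? (upTo n))))))
    (trans (last (length (filter P? (upTo n)))) (cong (_+ bit (does (P? n))) (length-filter-upTo P? n)))
    where
    last : ∀ l → ι (l ℕ.+ length (filter P? (n ∷ []))) ≡ ι l + bit (does (P? n))
    last l with does (P? n)
    ... | true  = trans (cong ι (ℕ.+-comm l 1)) (ι-suc l)
    ... | false = trans (cong ι (ℕ.+-identityʳ l)) (sym (ℚ.+-identityʳ (ι l)))

  module _ {b : ℕ → Bool} {c : ℚ} (1≤c : 1ℚ ≤ c) where

    private
      T : ℕ → ℚ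
      T = total (bit ∘ b)

      0≤c : 0ℚ ≤ c
      0≤c = 1≤⇒0≤ 1≤c

    -- Only the last true index `k` matters: up to it there are at most `k + 1` true bits, and its
    -- own hypothesis bounds `(k + 1) c`. With no true bit, `0 ≤ y` decides.
    total-bit-upper : ∀ {y} n → 0ℚ ≤ y → (∀ k → k ℕ.< n → b k ≡ true → ι (suc k) * c ≤ y) →
      T n * c ≤ y
    total-bit-upper {y} zero    0≤y h = subst (_≤ y) (sym (ℚ.*-zeroˡ c)) 0≤y
    total-bit-upper {y} (suc n) 0≤y h with b n in bn
    ... | true  = ℚ.≤-trans (*-monoʳ 0≤c (subst (T n + 1ℚ ≤_) (sym (ι-suc n))
      (ℚ.+-monoˡ-≤ 1ℚ (total-bit≤ b n)))) (h n ℕ.≤-refl bn)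
    ... | false = subst (λ t → t * c ≤ y) (sym (ℚ.+-identityʳ (T n)))
      (total-bit-upper n 0≤y λ k k<n → h k (ℕ.m≤n⇒m≤1+n k<n))

    -- Bits are true up to the first `k` with `x < (k + 1) c`. There the count is `k`, which gives
    -- the first alternative, and this persists because the count never decreases. Without such a
    -- `k` all bits are true.
    total-bit-lower : ∀ {x} n → (∀ k → k ℕ.< n → ι (suc k) * c ≤ x → b k ≡ true) →
      x ≤ (T n + 1ℚ) * c ⊎ T n ≡ ι n
    total-bit-lower     zero    h = inj₂ (sym ι0)
    total-bit-lower {x} (suc n) h
      with total-bit-lower n (λ k k<n → h k (ℕ.m≤n⇒m≤1+n k<n)) | ι (suc n) * c ℚ.≤? x
    ... | inj₁ x≤ | _ = inj₁ (ℚ.≤-trans x≤ (*-monoʳ 0≤c (ℚ.+-monoˡ-≤ 1ℚ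
      (subst (_≤ T n + bit (b n)) (ℚ.+-identityʳ (T n)) (ℚ.+-monoʳ-≤ (T n) (0≤bit (b n)))))))
    ... | inj₂ T≡ | yes le = inj₂ (trans (cong₂ _+_ T≡ (cong bit (h n ℕ.≤-refl le))) (sym (ι-suc n)))
    ... | inj₂ T≡ | no  nle = inj₁ (ℚ.≤-trans (ℚ.<⇒≤ (ℚ.≰⇒> nle)) (*-monoʳ 0≤c
      (subst (_≤ T n + bit (b n) + 1ℚ) (trans (cong (_+ 1ℚ) T≡) (sym (ι-suc n)))
        (ℚ.+-monoˡ-≤ 1ℚ (subst (_≤ T n + bit (b n)) (ℚ.+-identityʳ (T n))
          (ℚ.+-monoʳ-≤ (T n) (0≤bit (b n))))))))

    -- Here `d` is the reciprocal of `c`. Multiplying the two counting bounds by `d ≤ 1` leaves an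
    -- error of at most `f`, plus 1 for rounding. If all bits are true, the lower bound is
    -- `n d ≤ n`.
    total-bit-≈ : ∀ {d f} n → c * d ≡ 1ℚ → 0ℚ ≤ d → d ≤ 1ℚ → 0ℚ ≤ f →
      (∀ k → k ℕ.< n → b k ≡ true → ι (suc k) * c ≤ ι n + f) →
      (∀ k → k ℕ.< n → ι (suc k) * c ≤ ι n - f → b k ≡ true) →
      T n ≈[ f + 1ℚ ] ι n * d
    total-bit-≈ {d} {f} n cd≡1 0≤d d≤1 0≤f h₁ h₂ = within
      (ℚ.≤-trans (subst (_≤ (ι n + f) * d) (cancel (T n))
        (*-monoʳ 0≤d (total-bit-upper n (0≤+ (0≤ι n) 0≤f) h₁)))
        (≤-by (0≤+ 0≤f-fd 0≤1) (eq₁ (ι n) f d)))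
      below
      where
      cancel : ∀ t → t * c * d ≡ t
      cancel t = trans (ℚ.*-assoc t c d) (trans (cong (t *_) cd≡1) (ℚ.*-identityʳ t))
      0≤f-fd : 0ℚ ≤ f - f * d
      0≤f-fd = p≤q⇒0≤q-p (subst (f * d ≤_) (ℚ.*-identityʳ f) (*-monoˡ 0≤f d≤1))
      eq₁ : ∀ n f d → f - f * d + 1ℚ ≡ n * d + (f + 1ℚ) - (n + f) * d
      eq₁ = solve-∀ ring
      eq₂ : ∀ n f d t → (t + 1ℚ - (n - f) * d) + (f - f * d) ≡ t + (f + 1ℚ) - n * d
      eq₂ = solve-∀ ring
      eq₃ : ∀ n f d → (n - n * d) + (f + 1ℚ) ≡ n + (f + 1ℚ) - n * d
      eq₃ = solve-∀ ring
      below : ι n * d ≤ T n + (f + 1ℚ)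
      below with total-bit-lower n h₂
      ... | inj₁ le = ≤-by (0≤+ (p≤q⇒0≤q-p (subst ((ι n - f) * d ≤_) (cancel (T n + 1ℚ))
        (*-monoʳ 0≤d le))) 0≤f-fd) (eq₂ (ι n) f d (T n))
      ... | inj₂ eq = subst (λ t → ι n * d ≤ t + (f + 1ℚ)) (sym eq)
        (≤-by (0≤+ (p≤q⇒0≤q-p (subst (ι n * d ≤_) (ℚ.*-identityʳ (ι n)) (*-monoˡ (0≤ι n) d≤1)))
          (0≤+ 0≤f 0≤1)) (eq₃ (ι n) f d))

  -- Parity

  parity : ℕ → ℚ
  parity zero    = 0ℚ
  parity (suc s) = 1ℚ - parity s

  parity-bounds : ∀ s → Unit (parity s)
  parity-bounds zero    = 0-unit
  parity-bounds (suc s) = unit (p≤q⇒0≤q-p (≤1 (parity-bounds s))) (p-q≤p 1ℚ (0≤ (parity-bounds s)))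

  parity-+2 : ∀ s → parity (2 ℕ.+ s) ≡ parity s
  parity-+2 s = eq (parity s)
    where
    eq : ∀ x → 1ℚ - (1ℚ - x) ≡ x
    eq = solve-∀ ring

  2∣?-+2 : ∀ s z → does (+ 2 ∣? (+ (2 ℕ.+ s) ℤ.- z)) ≡ does (+ 2 ∣? (+ s ℤ.- z))
  2∣?-+2 s z = does-⇔ (mk⇔
    (λ d → ℤ.∣m+n∣m⇒∣n {+ 2} {+ 2} (subst (+ 2 ℤ.∣_) shift d) ℤ.∣-refl)
    (λ d → subst (+ 2 ℤ.∣_) (sym shift) (ℤ.∣m∣n⇒∣m+n ℤ.∣-refl d)))
    (+ 2 ∣? (+ (2 ℕ.+ s) ℤ.- z)) (+ 2 ∣? (+ s ℤ.- z))
    where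
    shift : + (2 ℕ.+ s) ℤ.- z ≡ + 2 ℤ.+ (+ s ℤ.- z)
    shift = ℤ.+-assoc (+ 2) (+ s) (ℤ.- z)

  odd-bit : ∀ s → bit (does (+ 2 ∣? (+ s ℤ.- + 1))) ≡ parity s
  odd-bit zero          = refl
  odd-bit (suc zero)    = refl
  odd-bit (suc (suc s)) =
    trans (cong bit (2∣?-+2 s (+ 1))) (trans (odd-bit s) (sym (parity-+2 s)))

  even-bit : ∀ s → bit (does (+ 2 ∣? (+ s ℤ.- + 2))) ≡ 1ℚ - parity s
  even-bit zero          = refl
  even-bit (suc zero)    = refl
  even-bit (suc (suc s)) =
    trans (cong bit (2∣?-+2 s (+ 2))) (trans (even-bit s) (cong (λ x → 1ℚ - x) (sym (parity-+2 s))))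

  count-odd : ∀ (t : ℕ → ℤ) (τ : ℕ → ℕ) n → (∀ k → k ℕ.< n → t k ≡ + τ k) →
    ι (length (filter (λ i → + 2 ∣? (t i ℤ.- + 1)) (upTo n))) ≡ total (parity ∘ τ) n
  count-odd t τ n t≡τ = trans (length-filter-upTo (λ i → + 2 ∣? (t i ℤ.- + 1)) n)
    (total-cong n λ k k<n →
      trans (cong (λ z → bit (does (+ 2 ∣? (z ℤ.- + 1)))) (t≡τ k k<n)) (odd-bit (τ k)))

  count-even : ∀ (t : ℕ → ℤ) (τ : ℕ → ℕ) n → (∀ k → k ℕ.< n → t k ≡ + τ k) →
    ι (length (filter (λ i → + 2 ∣? (t i ℤ.- + 2)) (upTo n))) ≡ ι n - total (parity ∘ τ) n
  count-even t τ n t≡τ = trans (length-filter-upTo (λ i → + 2 ∣? (t i ℤ.- + 2)) n)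
    (trans (total-cong n λ k k<n →
        trans (cong (λ z → bit (does (+ 2 ∣? (z ℤ.- + 2)))) (t≡τ k k<n)) (even-bit (τ k)))
      (total-complement (parity ∘ τ) n))

  -- The bit `i <ᵇ s` says that `s` reaches level `i + 1`. If `s ≤ m`, the sum consists of `s` ones
  -- followed by zeros and equals the parity; otherwise the error 1 is enough, as both sides lie
  -- between 0 and 1.
  parity-levels : ∀ m s → parity s ≈[ bit (m <ᵇ s) ] alt (λ i → bit (i <ᵇ s)) m
  parity-levels zero    zero    = ≈-refl
  parity-levels zero    (suc s) = within
    (ℚ.≤-trans (≤1 (parity-bounds (suc s))) (ℚ.≤-reflexive (sym (ℚ.+-identityˡ 1ℚ))))
    (0≤+ (0≤ (parity-bounds (suc s))) 0≤1)
  parity-levels (suc m) zero    = subst (0ℚ ≈[ 0ℚ ]_) (sym (alt-zero (suc m))) ≈-refl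
  parity-levels (suc m) (suc s) = subst (λ e → parity (suc s) ≈[ e ] alt (λ i → bit (i <ᵇ suc s)) (suc m))
    (ℚ.+-identityˡ (bit (m <ᵇ s))) (≈-subtract (≈-refl {1ℚ}) (parity-levels m s))

  total-parity : ∀ (τ : ℕ → ℕ) m n →
    total (parity ∘ τ) n ≈[ total (λ k → bit (m <ᵇ τ k)) n ] alt (λ i → total (λ k → bit (i <ᵇ τ k)) n) m
  total-parity τ m n = subst (total (parity ∘ τ) n ≈[ total (λ k → bit (m <ᵇ τ k)) n ]_)
    (total-alt (λ i k → bit (i <ᵇ τ k)) m n) (total-≈ (λ k → parity-levels m (τ k)) n)

  -- Real numbers and their floors

  p<p+q : ∀ p {q} → 0ℚ < q → p < p + q
  p<p+q p {q} 0<q = subst (_< p + q) (ℚ.+-identityʳ p) (ℚ.+-monoʳ-< p 0<q)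

  -- If `z < j`, then `x < z + 1 ≤ j` would hold with a uniform gap, against the late terms of the
  -- sequence.
  floor-≥ : ∀ {x z j} M → IsFloor x z → (∀ i → M ℕ.≤ i → fromℤ j ≤ seq x i) → j ℤ.≤ z
  floor-≥ {x} {z} {j} M (_ , ε , 0<ε , N , h) j≤x = ℤ.≮⇒≥ λ z<j → ℚ.<-irrefl refl
    (ℚ.<-≤-trans (p<p+q (seq x i) 0<ε) (ℚ.≤-trans (h i (ℕ.m≤n⊔m M N))
      (ℚ.≤-trans (/1-mono (ℤ.i<j⇒suc[i]≤j z<j)) (j≤x i (ℕ.m≤m⊔n M N)))))
    where
    i : ℕ
    i = M ℕ.⊔ N

  -- A rational `y` strictly below `j` is asked for because `j - y` serves as the uniform gap in
  -- `x < j ≤ z`.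
  floor-< : ∀ {x z j y} M → IsFloor x z → y < fromℤ j → (∀ i → M ℕ.≤ i → seq x i ≤ y) → z ℤ.< j
  floor-< {x} {z} {j} {y} M (z≤x , _) y<j x≤y = ℤ.≰⇒> λ j≤z → z≤x
    (fromℤ j - y , subst (_< fromℤ j - y) (ℚ.+-inverseʳ y) (ℚ.+-monoˡ-< (- y) y<j) , M , λ i M≤i →
      ℚ.≤-trans (≤-by {q = fromℤ j} (p≤q⇒0≤q-p (x≤y i M≤i)) (eq (seq x i) y (fromℤ j))) (/1-mono j≤z))
    where
    eq : ∀ x y j → y - x ≡ j - (x + (j - y))
    eq = solve-∀ ring

  half : ∀ {p} → 0ℚ < p → 0ℚ < p * ½
  half {p} 0<p = subst (_< p * ½) (ℚ.*-zeroˡ ½) (ℚ.*-monoˡ-<-pos ½ 0<p)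

  near : ∀ x {ε} → 0ℚ < ε → ∃ λ M → ∀ i j → M ℕ.≤ i → M ℕ.≤ j → seq x i ≈[ ε ] seq x j
  near x {ε} 0<ε = let (M , h) = cauchy x ε 0<ε in
    M , λ i j M≤i M≤j → ∣-∣≤⇒≈ (ℚ.<⇒≤ (h i j M≤i M≤j))

  -- One late term below `q - ε` would, by the Cauchy property, keep all late terms at or below
  -- `q - ε / 2`, contradicting `q ≤ x`.
  eventually-≥ : ∀ {x q ε} → fromℚ q Defs.≤ x → 0ℚ < ε → ∃ λ M → ∀ i → M ℕ.≤ i → q ≤ seq x i + ε
  eventually-≥ {x} {q} {ε} q≤x 0<ε = let (M , h) = near x (half 0<ε) in
    M , λ i M≤i → ℚ.≮⇒≥ λ x+ε<q → q≤x (ε * ½ , half 0<ε , M , λ l M≤l →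
      ℚ.≤-trans (≤-by {seq x l + ε * ½} {seq x i + ε} (p≤q⇒0≤q-p (upper (h l i M≤l M≤i)))
        (eq (seq x l) (seq x i) ε)) (ℚ.<⇒≤ x+ε<q))
    where
    eq : ∀ x y e → y + e * ½ - x ≡ y + e - (x + e * ½)
    eq = solve-∀ ring

  eventually-≤ : ∀ {x q ε} → x Defs.≤ fromℚ q → 0ℚ < ε → ∃ λ M → ∀ i → M ℕ.≤ i → seq x i ≤ q + ε
  eventually-≤ {x} {q} {ε} x≤q 0<ε = let (M , h) = near x (half 0<ε) in
    M , λ i M≤i → ℚ.≮⇒≥ λ q+ε<x → x≤q (ε * ½ , half 0<ε , M , λ l M≤l →
      ≤-by {q + ε * ½} {seq x l} (0≤+ (p≤q⇒0≤q-p (lower (h l i M≤l M≤i))) (p≤q⇒0≤q-p (ℚ.<⇒≤ q+ε<x)))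
        (eq (seq x l) (seq x i) q ε))
    where
    eq : ∀ x y q e → (x + e * ½ - y) + (y - (q + e)) ≡ x - (q + e * ½)
    eq = solve-∀ ring

  -- The offset enters the counts only through such a bound, so the limiting densities do not depend
  -- on it.
  bounded : ∀ x → ∃ λ V → 0ℚ ≤ V × ∃ λ M → ∀ i → M ℕ.≤ i → seq x i ≈[ V ] 0ℚ
  bounded x = let (M , h) = near x 0<1 in
    1ℚ + ∣ seq x M ∣ , 0≤+ 0≤1 (ℚ.0≤∣p∣ (seq x M)) , M , λ i M≤i →
    ≈-trans (h i M M≤i ℕ.≤-refl) (∣-∣≤⇒≈ (ℚ.≤-reflexive (cong ∣_∣ (ℚ.+-identityʳ (seq x M)))))

  clamp : ∀ p {ε} → 0ℚ ≤ ε → 0ℚ ≤ p + ε → p ≤ 1ℚ + ε → ∃ λ a → Unit a × p ≈[ ε ] a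
  clamp p {ε} 0≤ε 0≤p+ε p≤1+ε =
    [ (λ 0≤p → [ (λ p≤1 → p , unit 0≤p p≤1 , ≈-weaken 0≤ε ≈-refl) , above ]′ (ℚ.≤-total p 1ℚ))
    , below ]′ (ℚ.≤-total 0ℚ p)
    where
    above : 1ℚ ≤ p → ∃ λ a → Unit a × p ≈[ ε ] a
    above 1≤p = 1ℚ , 1-unit , within p≤1+ε
      (ℚ.≤-trans 1≤p (subst (_≤ p + ε) (ℚ.+-identityʳ p) (ℚ.+-monoʳ-≤ p 0≤ε)))
    below : p ≤ 0ℚ → ∃ λ a → Unit a × p ≈[ ε ] a
    below p≤0 = 0ℚ , 0-unit , within (ℚ.≤-trans p≤0 (0≤+ ℚ.≤-refl 0≤ε)) 0≤p+ε

  -- Late terms of `x` may lie slightly outside [0,1]; an approximation inside keeps every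
  -- denominator at least 1.
  near-unit : ∀ {x ε} → Defs.0ℝ Defs.≤ x → x Defs.≤ Defs.1ℝ → 0ℚ < ε →
    ∃ λ a → Unit a × ∃ λ M → ∀ i → M ℕ.≤ i → seq x i ≈[ ε ] a
  near-unit {x} {ε} 0≤x x≤1 0<ε =
    let (M , h)        = near x (half 0<ε)
        (M₀ , h₀)      = eventually-≥ {x} {0ℚ} 0≤x (half 0<ε)
        (M₁ , h₁)      = eventually-≤ {x} {1ℚ} x≤1 (half 0<ε)
        i              = M ℕ.⊔ M₀ ℕ.⊔ M₁
        M⊔M₀≤i         = ℕ.m≤m⊔n (M ℕ.⊔ M₀) M₁
        (a , ua , x≈a) = clamp (seq x i) (ℚ.<⇒≤ (half 0<ε))
                           (h₀ i (ℕ.m⊔n≤o⇒n≤o M M₀ M⊔M₀≤i)) (h₁ i (ℕ.m≤n⊔m (M ℕ.⊔ M₀) M₁))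
    in a , ua , M , λ l M≤l → subst (seq x l ≈[_] a) (eq ε)
         (≈-trans (h l i M≤l (ℕ.m⊔n≤o⇒m≤o M M₀ M⊔M₀≤i)) x≈a)
    where
    eq : ∀ e → e * ½ + e * ½ ≡ e
    eq = solve-∀ ring

  -- Counting the terms of the sequence that reach a given level

  <⇒<ᵇ≡true : ∀ {m n} → m ℕ.< n → (m <ᵇ n) ≡ true
  <⇒<ᵇ≡true m<n = Equivalence.to Bool.T-≡ (ℕ.<⇒<ᵇ m<n)

  <ᵇ≡true⇒< : ∀ {m n} → (m <ᵇ n) ≡ true → m ℕ.< n
  <ᵇ≡true⇒< {m} {n} eq = ℕ.<ᵇ⇒< m n (Equivalence.from Bool.T-≡ eq)

  ≈-cancel : ∀ {p q e r} → 1ℚ ≤ r → p * r ≈[ e * r ] q * r → p ≈[ e ] q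
  ≈-cancel {p} {q} {e} {r} 1≤r (within u l) = within
    (*-cancelʳ-≤ 1≤r (subst (p * r ≤_) (sym (ℚ.*-distribʳ-+ r q e)) u))
    (*-cancelʳ-≤ 1≤r (subst (q * r ≤_) (sym (ℚ.*-distribʳ-+ r p e)) l))

  three : ℚ
  three = + 3 / 1

  1≤ι-nonZero : ∀ n .{{_ : ℕ.NonZero n}} → 1ℚ ≤ ι n
  1≤ι-nonZero (suc n) = 1≤ι n

  complement-≈ : ∀ {p q r e} → p ≈[ e * r ] q * r → r - p ≈[ e * r ] (1ℚ - q) * r
  complement-≈ {p} {q} {r} {e} h = subst₂ (λ d x → r - p ≈[ d ] x)
    (ℚ.+-identityˡ (e * r)) (eq r q) (≈-subtract (≈-refl {r}) h)
    where
    eq : ∀ r q → r - q * r ≡ (1ℚ - q) * r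
    eq = solve-∀ ring

  -- Error budget of the counts

  module _ {V δ θ : ℚ} (0≤δ : 0ℚ ≤ δ) (0≤V : 0ℚ ≤ V) (θ≤½ : θ ≤ ½) (m n : ℕ)
    (mδ≡θ : ι (suc m) * δ ≡ θ) (large : ι (suc m) * (V + 1ℚ) ≤ ι n * θ) where

    private
      s : ℚ
      s = V + ι n * δ

      0≤s : 0ℚ ≤ s
      0≤s = 0≤+ 0≤V (0≤* (0≤ι n) 0≤δ)

    -- The constants cost `(m + 1)(V + 1)`, at most `n θ` for large `n`; the error in the shift
    -- costs `n (m + 1) δ`, which is `n θ` by the choice of `δ`.
    error≤ : ι (suc m) * (V + ι n * δ + 1ℚ) ≤ ι n * θ + ι n * θ
    error≤ = ≤-by (p≤q⇒0≤q-p large) (trans (eq (ι (suc m)) V (ι n) δ (ι n * θ))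
      (cong (λ z → ι n * θ + ι n * z - ι (suc m) * (V + ι n * δ + 1ℚ)) mδ≡θ))
      where
      eq : ∀ m V n δ x → x - m * (V + 1ℚ) ≡ x + n * (m * δ) - m * (V + n * δ + 1ℚ)
      eq = solve-∀ ring

    slack≤ : V + ι n * δ ≤ ι n
    slack≤ = ℚ.≤-trans {j = ι (suc m) * (s + 1ℚ)}
      (≤-by (0≤+ (0≤* (p≤q⇒0≤q-p (1≤ι m)) (0≤+ 0≤s 0≤1)) 0≤1) (eq₁ (ι (suc m)) s))
      (ℚ.≤-trans error≤ (≤-by (0≤* (0≤ι n) (0≤+ (p≤q⇒0≤q-p θ≤½) (p≤q⇒0≤q-p θ≤½))) (eq₂ (ι n) θ)))
      where
      eq₁ : ∀ m s → (m - 1ℚ) * (s + 1ℚ) + 1ℚ ≡ m * (s + 1ℚ) - s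
      eq₁ = solve-∀ ring
      eq₂ : ∀ n t → n * ((½ - t) + (½ - t)) ≡ n - (n * t + n * t)
      eq₂ = solve-∀ ring

    -- One `θ` each for the truncation, the constants and the approximation of the shift.
    total-error≤ : ∀ {w} → w ≤ θ → ι n * w + ι (suc m) * (V + ι n * δ + 1ℚ) ≤ three * θ * ι n
    total-error≤ {w} w≤θ = ≤-by (0≤+ (0≤* (0≤ι n) (p≤q⇒0≤q-p w≤θ)) (p≤q⇒0≤q-p error≤))
      (eq (ι n) θ w (ι (suc m) * (V + ι n * δ + 1ℚ)))
      where
      eq : ∀ n t w e → n * (t - w) + (n * t + n * t - e) ≡ three * t * n - (n * w + e)
      eq = solve-∀ ring

  -- All that the limit arguments use about the counts. The densities are abstract sequences here,
  -- so no floor can be unfolded.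
  record Approximation (odd even : (n : ℕ) → .{{ℕ.NonZero n}} → ℚ) (α : ℝ) (θ : ℚ) : Set where
    field
      a       : ℚ
      a-unit  : Unit a
      level   : ℕ
      mesh≤   : mesh level ≤ θ
      start   : ℕ
      α≈a     : ∀ i → start ℕ.≤ i → seq α i ≈[ θ ] a
      bound   : ℕ
      odd-≈S  : ∀ n .{{_ : ℕ.NonZero n}} → bound ℕ.≤ n →
                odd n ≈[ three * θ ] oddPart a (2 ℕ.+ level)
      even-≈S : ∀ n .{{_ : ℕ.NonZero n}} → bound ℕ.≤ n →
                even n ≈[ three * θ ] 1ℚ - oddPart a (2 ℕ.+ level)

  approximation-by-counts : ∀ {odd even : (n : ℕ) → .{{ℕ.NonZero n}} → ℚ} {α θ a j} {o e : ℕ → ℚ}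
    M N → Unit a → mesh j ≤ θ → (∀ i → M ℕ.≤ i → seq α i ≈[ θ ] a) →
    (∀ n .{{_ : ℕ.NonZero n}} → odd n * ι n ≡ o n) →
    (∀ n .{{_ : ℕ.NonZero n}} → even n * ι n ≡ e n) →
    (∀ n → N ℕ.≤ n → e n ≡ ι n - o n) →
    (∀ n → N ℕ.≤ n → o n ≈[ three * θ * ι n ] ι n * oddPart a (2 ℕ.+ j)) →
    Approximation odd even α θ
  approximation-by-counts {θ = θ} {a} {j} {o} {e} M N ua mesh≤θ α≈a odd≡ even≡ e≡ o≈ = record
    { a = a ; a-unit = ua ; level = j ; mesh≤ = mesh≤θ ; start = M ; α≈a = α≈a ; bound = N
    ; odd-≈S = λ n N≤n → ≈-cancel (1≤ι-nonZero n)
        (subst (_≈[ three * θ * ι n ] oddPart a (2 ℕ.+ j) * ι n) (sym (odd≡ n)) (o≈′ n N≤n))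
    ; even-≈S = λ n N≤n → ≈-cancel (1≤ι-nonZero n)
        (subst (_≈[ three * θ * ι n ] (1ℚ - oddPart a (2 ℕ.+ j)) * ι n)
          (sym (trans (even≡ n) (e≡ n N≤n)))
          (complement-≈ {o n} {oddPart a (2 ℕ.+ j)} {ι n} {three * θ} (o≈′ n N≤n)))
    }
    where
    o≈′ : ∀ n → N ℕ.≤ n → o n ≈[ three * θ * ι n ] oddPart a (2 ℕ.+ j) * ι n
    o≈′ n N≤n = subst (o n ≈[ three * θ * ι n ]_) (ℚ.*-comm (ι n) (oddPart a (2 ℕ.+ j))) (o≈ n N≤n)

  -- em is fixed for the whole module: passing it on to a lemma would eta-expand
  -- it, and conversion checking would then unfold the terms of the sequence.
  module Counting (em : ExcludedMiddle 0ℓ) where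

    -- Opaque because conversion checking would otherwise unfold the search in the
    -- definition of the floor.
    opaque
      floorTerm : (α ν : ℝ) (n k : ℕ) → ℤ
      floorTerm α ν n k = term em n α ν (suc k)

      term≡floorTerm : ∀ α ν n k → term em n α ν (suc k) ≡ floorTerm α ν n k
      term≡floorTerm α ν n k = refl

      floorTerm-isFloor : ∀ α ν n k →
        IsFloor ((fromℚ (fromℤ (+ n)) Defs.- ν) Defs./ suc k Defs.+ α) (floorTerm α ν n k)
      floorTerm-isFloor α ν n k =
        proj₂ (floor-exists em ((fromℚ (fromℤ (+ n)) Defs.- ν) Defs./ suc k Defs.+ α))

    density*n : ∀ α ν r m .{{_ : ℕ.NonZero m}} n .{{_ : ℕ.NonZero n}} →
      density em α ν r m n * ι n ≡ ι (𝒩 em n α ν r m)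
    density*n α ν r m n = m/n*n (𝒩 em n α ν r m) n

    module _ (α ν : ℝ) {a δ V : ℚ} (ua : Unit a) (0≤δ : 0ℚ ≤ δ) (0≤V : 0ℚ ≤ V)
      (M : ℕ) (α≈a : ∀ i → M ℕ.≤ i → seq α i ≈[ δ ] a) (ν≈0 : ∀ i → M ℕ.≤ i → seq ν i ≈[ V ] 0ℚ)
      (n : ℕ) where

      -- A term is at least `j` when `k (j - α) ≤ n - ν`. Replacing `α` by `a` and `ν` by 0 shifts
      -- this condition by at most `k δ + V`, and `k ≤ n`.
      slack : ℚ
      slack = V + ι n * δ

      module _ {k : ℕ} (k<n : k ℕ.< n) where

        private
          κ r : ℚ
          κ = ι (suc k)
          r = + 1 / suc k

          -- Definitionally the sequence of the real number `ξ` whose floor is taken.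
          x : ℕ → ℚ
          x i = (+ n / 1 - seq ν i) * r + seq α i

          κ≤n : κ ≤ ι n
          κ≤n = ι-mono k<n

          0≤κ : 0ℚ ≤ κ
          0≤κ = 0≤ι (suc k)

          rκ≡1 : r * κ ≡ 1ℚ
          rκ≡1 = trans (m/n*n 1 (suc k)) ι1

          xκ : ∀ i → x i * κ ≡ ι n - seq ν i + seq α i * κ
          xκ i = trans (cong (λ m → ((m - seq ν i) * r + seq α i) * κ) (sym (ι≡/1 n)))
            (trans (eq (ι n - seq ν i) r (seq α i) κ)
              (trans (cong (λ z → (ι n - seq ν i) * z + seq α i * κ) rκ≡1)
                (cong (_+ seq α i * κ) (ℚ.*-identityʳ (ι n - seq ν i)))))
            where
            eq : ∀ m r y k → (m * r + y) * k ≡ m * (r * k) + y * k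
            eq = solve-∀ ring

          ξ : ℝ
          ξ = (fromℚ (fromℤ (+ n)) Defs.- ν) Defs./ suc k Defs.+ α

          isFloor : IsFloor ξ (floorTerm α ν n k)
          isFloor = floorTerm-isFloor α ν n k

        -- After multiplication by `κ` only linear estimates remain. The rational `q` allows `j` to
        -- be given as `0ℚ` or as the opaque `ι j`.
        term-≥ : ∀ j {q} → q ≡ fromℤ j → κ * (q - a) ≤ ι n - slack → j ℤ.≤ floorTerm α ν n k
        term-≥ j {q} refl h = floor-≥ {ξ} M isFloor λ i M≤i → *-cancelʳ-≤ {q = x i} (1≤ι k)
          (subst (fromℤ j * κ ≤_) (sym (xκ i)) (≤-by
            (0≤+ (p≤q⇒0≤q-p h) (0≤+ (p≤q⇒0≤q-p (upper (ν≈0 i M≤i)))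
              (0≤+ (p≤q⇒0≤q-p (*-monoʳ 0≤δ κ≤n)) (0≤* 0≤κ (p≤q⇒0≤q-p (lower (α≈a i M≤i)))))))
            (eq (ι n) V δ κ (fromℤ j) a (seq ν i) (seq α i))))
          where
          eq : ∀ n V δ κ j a v y →
            (n - (V + n * δ) - κ * (j - a)) + ((0ℚ + V - v) + ((n * δ - κ * δ) + κ * (y + δ - a)))
              ≡ n - v + y * κ - j * κ
          eq = solve-∀ ring

        term-< : ∀ j {q} → q ≡ fromℤ j → ι n + slack < κ * (q - a) → floorTerm α ν n k ℤ.< j
        term-< j refl h = floor-< {ξ} {y = y} M isFloor y<j λ i M≤i → *-cancelʳ-≤ {x i} {y} (1≤ι k)
          (subst₂ _≤_ (sym (xκ i)) (sym yκ) (≤-by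
            (0≤+ (p≤q⇒0≤q-p (lower (ν≈0 i M≤i))) (0≤* 0≤κ (p≤q⇒0≤q-p (upper (α≈a i M≤i)))))
            (eq₂ (ι n) V δ κ a (seq ν i) (seq α i))))
          where
          -- The largest value that the bounds on offset and shift allow. It does not depend on `i`,
          -- as `floor-<` requires.
          y : ℚ
          y = (ι n + V) * r + (a + δ)
          eq₁ : ∀ m r y k → (m * r + y) * k ≡ m * (r * k) + y * k
          eq₁ = solve-∀ ring
          yκ : y * κ ≡ ι n + V + (a + δ) * κ
          yκ = trans (eq₁ (ι n + V) r (a + δ) κ)
            (trans (cong (λ z → (ι n + V) * z + (a + δ) * κ) rκ≡1)
              (cong (_+ (a + δ) * κ) (ℚ.*-identityʳ (ι n + V))))
          eq₂ : ∀ n V δ κ a v y →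
            (v + V - 0ℚ) + κ * (a + δ - y) ≡ n + V + (a + δ) * κ - (n - v + y * κ)
          eq₂ = solve-∀ ring
          eq₃ : ∀ n V δ κ j a →
            (n + V + (a + δ) * κ - j * κ) + (n * δ - κ * δ) ≡ n + (V + n * δ) - κ * (j - a)
          eq₃ = solve-∀ ring
          y<j : y < fromℤ j
          y<j = ℚ.≰⇒> λ j≤y → ℚ.<-irrefl refl (ℚ.<-≤-trans h (≤-by
            (0≤+ (p≤q⇒0≤q-p (subst (fromℤ j * κ ≤_) yκ (*-monoʳ 0≤κ j≤y)))
                 (p≤q⇒0≤q-p (*-monoʳ 0≤δ κ≤n)))
            (eq₃ (ι n) V δ κ (fromℤ j) a)))

      private
        -- Levels are counted for natural numbers. Once `slack ≤ n`, `term≡τ` shows that the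
        -- absolute values are the terms themselves.
        τ : ℕ → ℕ
        τ k = ℤ.∣ floorTerm α ν n k ∣

        A : ℕ → ℚ
        A i = total (λ k → bit (i <ᵇ τ k)) n

      module _ (slack≤n : slack ≤ ι n) where

        private
          0≤slack : 0ℚ ≤ slack
          0≤slack = 0≤+ 0≤V (0≤* (0≤ι n) 0≤δ)

          term≡τ : ∀ {k} → k ℕ.< n → + τ k ≡ floorTerm α ν n k
          term≡τ {k} k<n = ℤ.0≤i⇒+∣i∣≡i (term-≥ k<n (+ 0) {0ℚ} refl
            (≤-by (0≤+ (p≤q⇒0≤q-p slack≤n) (0≤* (0≤ι (suc k)) (0≤ ua))) (eq (ι n) slack (ι (suc k)) a)))
            where
            eq : ∀ n s κ a → (n - s) + κ * a ≡ n - s - κ * (0ℚ - a)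
            eq = solve-∀ ring

          term≡ : ∀ {k} → k ℕ.< n → term em n α ν (suc k) ≡ + τ k
          term≡ {k} k<n = trans (term≡floorTerm α ν n k) (sym (term≡τ k<n))

          term-≥τ : ∀ {k} → k ℕ.< n → ∀ j → ι (suc k) * (ι j - a) ≤ ι n - slack → j ℕ.≤ τ k
          term-≥τ {k} k<n j h = ℤ.drop‿+≤+ (subst (+ j ℤ.≤_) (sym (term≡τ k<n))
            (term-≥ k<n (+ j) (ι≡/1 j) h))

          term-<τ : ∀ {k} → k ℕ.< n → ∀ j → j ℕ.≤ τ k → ι (suc k) * (ι j - a) ≤ ι n + slack
          term-<τ {k} k<n j j≤τ = ℚ.≮⇒≥ λ h → ℕ.<-irrefl refl (ℕ.<-≤-trans
            (ℤ.drop‿+<+ (subst (ℤ._< + j) (sym (term≡τ k<n))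
              (term-< k<n (+ j) (ι≡/1 j) h))) j≤τ)

          -- At the lowest level the denominator 1 stands in for `1 - a`, which may vanish. The
          -- upper bound then holds for every `k ≤ n`, and `k (1 - a) ≤ k` gives the converse in
          -- `level-lower`.
          level-upper : ∀ i k → k ℕ.< n → (i <ᵇ τ k) ≡ true →
            ι (suc k) * denominator a i ≤ ι n + slack
          level-upper zero    k k<n _  = subst₂ _≤_ (sym (ℚ.*-identityʳ (ι (suc k)))) refl
            (ℚ.≤-trans (ι-mono k<n) (subst (_≤ ι n + slack) (ℚ.+-identityʳ (ι n)) (ℚ.+-monoʳ-≤ (ι n) 0≤slack)))
          level-upper (suc i) k k<n eq = term-<τ k<n (suc (suc i)) (<ᵇ≡true⇒< eq)

          level-lower : ∀ i k → k ℕ.< n → ι (suc k) * denominator a i ≤ ι n - slack →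
            (i <ᵇ τ k) ≡ true
          level-lower zero    k k<n h = <⇒<ᵇ≡true (term-≥τ k<n 1
            (ℚ.≤-trans (*-monoˡ (0≤ι (suc k)) (subst (λ z → z - a ≤ 1ℚ) (sym ι1) (p-q≤p 1ℚ (0≤ ua)))) h))
          level-lower (suc i) k k<n h = <⇒<ᵇ≡true (term-≥τ k<n (suc (suc i)) h)

          weight≤1 : ∀ i → weight a i ≤ 1ℚ
          weight≤1 zero    = ℚ.≤-refl
          weight≤1 (suc i) = inv≤1 (1≤denominator ua (suc i))

          level-≈ : ∀ i → A i ≈[ slack + 1ℚ ] ι n * weight a i
          level-≈ i = total-bit-≈ (1≤denominator ua i) n (denominator*weight ua i)
            (nonneg (weight-decreasing ua) i) (weight≤1 i) 0≤slack (level-upper i) (level-lower i)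

          odd-total : ι (𝒩 em n α ν (+ 1) 2) ≡ total (parity ∘ τ) n
          odd-total = count-odd (λ k → term em n α ν (suc k)) τ n λ k → term≡

        even-odd : ι (𝒩 em n α ν (+ 2) 2) ≡ ι n - ι (𝒩 em n α ν (+ 1) 2)
        even-odd = trans (count-even (λ k → term em n α ν (suc k)) τ n λ k → term≡)
          (cong (λ z → ι n - z) (sym odd-total))

        -- Each of the `m` levels costs `slack + 1`. The number of terms beyond level `m` is itself
        -- estimated by `level-≈ m`, which adds `ι n * weight a m` and one more `slack + 1`.
        odd-≈ : ∀ m → ι (𝒩 em n α ν (+ 1) 2)
          ≈[ ι n * weight a m + ι (suc m) * (slack + 1ℚ) ] ι n * oddPart a m
        odd-≈ m = subst₂ (_≈[ ι n * weight a m + ι (suc m) * (slack + 1ℚ) ]_)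
          (sym odd-total) (alt-scale (ι n) (weight a) m)
          (≈-weaken (≤-by (p≤q⇒0≤q-p (upper (level-≈ m)))
              (trans (eq (ι n * weight a m) (slack + 1ℚ) (ι m) (A m))
                (cong (λ z → ι n * weight a m + z * (slack + 1ℚ) - (A m + ι m * (slack + 1ℚ))) (sym (ι-suc m)))))
            (≈-trans (total-parity τ m n) (alt-≈ level-≈ m)))
          where
          eq : ∀ w s m A → w + s - A ≡ w + (m + 1ℚ) * s - (A + m * s)
          eq = solve-∀ ring

    approximate : ∀ α ν {θ} →
      Defs.0ℝ Defs.≤ α → α Defs.≤ Defs.1ℝ → 0ℚ < θ → θ ≤ ½ →
      Approximation (density em α ν (+ 1) 2) (density em α ν (+ 2) 2) α θ
    approximate α ν {θ} 0≤α α≤1 0<θ θ≤½ =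
      -- The order matters: `θ` fixes the truncation, the truncation fixes the precision
      -- `θ / (3 + j)` of the shift, and only then is `n` taken large.
      let (j , mesh≤θ)       = inv-small 0<θ
          (a , ua , Mα , α≈) = near-unit {α} 0≤α α≤1 (0<δ (2 ℕ.+ j))
          (V , 0≤V , Mν , ν≈) = bounded ν
          (N , large)        = archimedean (ι (3 ℕ.+ j) * (V + 1ℚ)) 0<θ
      in package ua 0≤V (mesh≤θ j ℕ.≤-refl) Mα α≈ Mν ν≈ N large
      where
      δ : ℕ → ℚ
      δ m = inv (ι (suc m)) * θ

      0<δ : ∀ m → 0ℚ < δ m
      0<δ m = subst (_< δ m) (ℚ.*-zeroʳ (inv (ι (suc m))))
        (ℚ.*-monoʳ-<-pos (inv (ι (suc m))) {{positive (0<inv (1≤ι m))}} 0<θ)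

      δ≤θ : ∀ m → δ m ≤ θ
      δ≤θ m = subst (δ m ≤_) (ℚ.*-identityˡ θ) (*-monoʳ (ℚ.<⇒≤ 0<θ) (inv≤1 (1≤ι m)))

      mδ≡θ : ∀ m → ι (suc m) * δ m ≡ θ
      mδ≡θ m = trans (sym (ℚ.*-assoc (ι (suc m)) (inv (ι (suc m))) θ))
        (trans (cong (_* θ) (*-inv (1≤ι m))) (ℚ.*-identityˡ θ))

      package : ∀ {j a V} → Unit a → 0ℚ ≤ V → mesh j ≤ θ →
        ∀ Mα → (∀ i → Mα ℕ.≤ i → seq α i ≈[ δ (2 ℕ.+ j) ] a) →
        ∀ Mν → (∀ i → Mν ℕ.≤ i → seq ν i ≈[ V ] 0ℚ) →
        ∀ N → (∀ n → N ℕ.≤ n → ι (3 ℕ.+ j) * (V + 1ℚ) ≤ ι n * θ) →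
        Approximation (density em α ν (+ 1) 2) (density em α ν (+ 2) 2) α θ
      package {j} {a} {V} ua 0≤V mesh≤θ Mα α≈ Mν ν≈ N large = approximation-by-counts
        {o = λ n → ι (𝒩 em n α ν (+ 1) 2)} {e = λ n → ι (𝒩 em n α ν (+ 2) 2)}
        Mα N ua mesh≤θ (λ i h → ≈-weaken (δ≤θ (2 ℕ.+ j)) (α≈ i h))
        (λ n → density*n α ν (+ 1) 2 n) (λ n → density*n α ν (+ 2) 2 n)
        (λ n N≤n → even-odd α ν ua 0≤δ 0≤V M α≈′ ν≈′ n (slack≤n n N≤n))
        (λ n N≤n → ≈-weaken (total-error≤ 0≤δ 0≤V θ≤½ (2 ℕ.+ j) n (mδ≡θ (2 ℕ.+ j)) (large n N≤n)
              (ℚ.≤-trans (weight≤mesh ua j) mesh≤θ))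
            (odd-≈ α ν ua 0≤δ 0≤V M α≈′ ν≈′ n (slack≤n n N≤n) (2 ℕ.+ j)))
        where
        M : ℕ
        M = Mα ℕ.⊔ Mν

        0≤δ : 0ℚ ≤ δ (2 ℕ.+ j)
        0≤δ = ℚ.<⇒≤ (0<δ (2 ℕ.+ j))

        α≈′ : ∀ i → M ℕ.≤ i → seq α i ≈[ δ (2 ℕ.+ j) ] a
        α≈′ i M≤i = α≈ i (ℕ.m⊔n≤o⇒m≤o Mα Mν M≤i)

        ν≈′ : ∀ i → M ℕ.≤ i → seq ν i ≈[ V ] 0ℚ
        ν≈′ i M≤i = ν≈ i (ℕ.m⊔n≤o⇒n≤o Mα Mν M≤i)

        slack≤n : ∀ n → N ℕ.≤ n → V + ι n * δ (2 ℕ.+ j) ≤ ι n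
        slack≤n n N≤n = slack≤ 0≤δ 0≤V θ≤½ (2 ℕ.+ j) n (mδ≡θ (2 ℕ.+ j)) (large n N≤n)

  -- Limits and uniqueness

  hundred : ℚ
  hundred = + 100 / 1

  -- Every final error is a multiple of `θ` by at most 73, so this one scale serves all of them. The
  -- witness `min(ε, 1) / 100` also ensures `θ ≤ ½`.
  hundredth : ∀ {ε} → 0ℚ < ε → ∃ λ θ → 0ℚ < θ × θ ≤ ½ × hundred * θ ≤ ε
  hundredth {ε} 0<ε =
    [ (λ ε≤1 → scale 0<ε ε≤1 ℚ.≤-refl) , scale (0<1) ℚ.≤-refl ]′ (ℚ.≤-total ε 1ℚ)
    where
    scale : ∀ {η} → 0ℚ < η → η ≤ 1ℚ → η ≤ ε → ∃ λ θ → 0ℚ < θ × θ ≤ ½ × hundred * θ ≤ ε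
    scale {η} 0<η η≤1 η≤ε = + 1 / 100 * η
      , subst (_< + 1 / 100 * η) (ℚ.*-zeroʳ (+ 1 / 100)) (ℚ.*-monoʳ-<-pos (+ 1 / 100) 0<η)
      , ℚ.≤-trans (*-monoˡ {r = + 1 / 100} (from-yes (0ℚ ℚ.≤? + 1 / 100)) η≤1) (from-yes (+ 1 / 100 * 1ℚ ℚ.≤? ½))
      , subst (_≤ ε) (sym (eq η)) η≤ε
      where
      eq : ∀ x → hundred * (+ 1 / 100 * x) ≡ x
      eq = solve-∀ ring

  multiple-< : ∀ {c θ ε} → c < hundred → 0ℚ < θ → hundred * θ ≤ ε → c * θ < ε
  multiple-< {c} {θ} c<100 0<θ h = ℚ.<-≤-trans (ℚ.*-monoˡ-<-pos θ {{positive 0<θ}} c<100) h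

  ≈⇒∣-∣< : ∀ {p q c θ ε} → c < hundred → 0ℚ < θ → hundred * θ ≤ ε → p ≈[ c * θ ] q → ∣ p - q ∣ < ε
  ≈⇒∣-∣< c<100 0<θ h p≈q = ℚ.≤-<-trans (≈⇒∣-∣≤ p≈q) (multiple-< c<100 0<θ h)

  -- Both roots are compared with `root M`, at a cost of 12 times `3 θ` each.
  roots-cauchy : ∀ {θ} → 0ℚ < θ → ∃ λ M → ∀ j k → M ℕ.≤ j → M ℕ.≤ k → root j ≈[ + 72 / 1 * θ ] root k
  roots-cauchy {θ} 0<θ = let (M , h) = inv-small 0<θ in
    M , λ j k M≤j M≤k → subst (root j ≈[_] root k)
      (trans (cong (λ c → c * (θ + (θ + θ)) + c * (θ + (θ + θ))) (ι≡/1 12)) (eq θ))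
      (≈-trans (≈-sym (close (h M ℕ.≤-refl) M≤j)) (close (h M ℕ.≤-refl) M≤k))
    where
    eq : ∀ t → + 12 / 1 * (t + (t + t)) + + 12 / 1 * (t + (t + t)) ≡ + 72 / 1 * t
    eq = solve-∀ ring
    close : ∀ {M k} → mesh M ≤ θ → M ℕ.≤ k → root M ≈[ ι 12 * (θ + (θ + θ)) ] root k
    close mesh≤θ M≤k = ≈-weaken
      (*-monoˡ (0≤ι 12) (ℚ.+-mono-≤ mesh≤θ (ℚ.+-mono-≤ mesh≤θ mesh≤θ))) (root-≈ M≤k)

  halvingShift : ℝ
  halvingShift = mkℝ root λ ε 0<ε →
    let (θ , 0<θ , _ , 100θ≤ε) = hundredth 0<ε
        (M , h)                = roots-cauchy 0<θ
    in M , λ j k M≤j M≤k → ≈⇒∣-∣< (from-yes (+ 72 / 1 ℚ.<? hundred)) 0<θ 100θ≤ε (h j k M≤j M≤k)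

  0≤halvingShift : Defs.0ℝ Defs.≤ halvingShift
  0≤halvingShift (ε , 0<ε , M , h) = ℚ.<-irrefl refl (ℚ.<-≤-trans (p<p+q (root M) 0<ε)
    (ℚ.≤-trans (h M ℕ.≤-refl) (0≤ (root-unit M))))

  halvingShift≤1 : halvingShift Defs.≤ Defs.1ℝ
  halvingShift≤1 (ε , 0<ε , M , h) = ℚ.<-irrefl refl (ℚ.<-≤-trans (p<p+q 1ℚ 0<ε)
    (ℚ.≤-trans (h M ℕ.≤-refl) (≤1 (root-unit M))))

  module _ {odd even : (n : ℕ) → .{{ℕ.NonZero n}} → ℚ} where

    open Approximation

    -- The sequence of `halvingShift` is `root`. Passing from `a` to a late `root i` costs `θ` by
    -- the Lipschitz bound, and `oddPart-root` costs two meshes.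
    oddPart-half : ∀ {θ} (A : Approximation odd even halvingShift θ) →
      oddPart (a A) (2 ℕ.+ level A) ≈[ + 3 / 1 * θ ] ½
    oddPart-half {θ} A = subst (oddPart (a A) (2 ℕ.+ level A) ≈[_] ½) (eq θ)
      (≈-trans
        (oddPart-≈ (a-unit A) (root-unit i) (≈-sym (α≈a A i (ℕ.m≤m⊔n (start A) (level A)))) (suc (level A)))
        (≈-weaken (ℚ.+-mono-≤ (mesh≤ A) (mesh≤ A)) (oddPart-root (ℕ.m≤n⊔m (start A) (level A)))))
      where
      i : ℕ
      i = start A ℕ.⊔ level A
      eq : ∀ t → t + (t + t) ≡ + 3 / 1 * t
      eq = solve-∀ ring

    module _ (approximations : ∀ {θ} → 0ℚ < θ → θ ≤ ½ → Approximation odd even halvingShift θ) where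

      odd⟶½ : odd ⟶ ½
      odd⟶½ ε 0<ε =
        let (θ , 0<θ , θ≤½ , 100θ≤ε) = hundredth 0<ε
            A = approximations 0<θ θ≤½
        -- The counts contribute `3 θ` and `oddPart-half` another `3 θ`.
        in bound A , λ n N≤n → ≈⇒∣-∣< (from-yes (+ 6 / 1 ℚ.<? hundred)) 0<θ 100θ≤ε
          (subst (odd n ≈[_] ½) (eq θ) (≈-trans (odd-≈S A n N≤n) (oddPart-half A)))
        where
        eq : ∀ t → three * t + + 3 / 1 * t ≡ + 6 / 1 * t
        eq = solve-∀ ring

      even⟶½ : even ⟶ ½
      even⟶½ ε 0<ε =
        let (θ , 0<θ , θ≤½ , 100θ≤ε) = hundredth 0<ε
            A = approximations 0<θ θ≤½
        in bound A , λ n N≤n → ≈⇒∣-∣< (from-yes (+ 6 / 1 ℚ.<? hundred)) 0<θ 100θ≤ε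
          (subst (even n ≈[_] ½) (eq θ) (≈-trans (even-≈S A n N≤n)
            (≈-subtract (≈-refl {1ℚ}) (oddPart-half A))))
        where
        eq : ∀ t → three * t + (0ℚ + + 3 / 1 * t) ≡ + 6 / 1 * t
        eq = solve-∀ ring

    module _ {α : ℝ} (approximations : ∀ {θ} → 0ℚ < θ → θ ≤ ½ → Approximation odd even α θ)
      (odd⟶½ : odd ⟶ ½) where

      private
        -- The density at one large `n` links the sum at `a` to 1/2. The error is `θ` from `α` to
        -- `a`, plus 12 times the sum of `3 θ` for the counts, `θ` for the limit and `2 θ` for the
        -- root.
        near-root : ∀ {θ} → 0ℚ < θ → (A : Approximation odd even α θ) →
          ∀ i → start A ℕ.⊔ level A ℕ.≤ i → seq α i ≈[ + 73 / 1 * θ ] root i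
        near-root {θ} 0<θ A i M≤i =
          let (M , h) = odd⟶½ θ 0<θ
              -- A successor, so that `NonZero n` is found by instance search.
              n = suc (bound A ℕ.⊔ M)
              N≤n = ℕ.m≤n⇒m≤1+n (ℕ.m≤m⊔n (bound A) M)
              M≤n = ℕ.m≤n⇒m≤1+n (ℕ.m≤n⊔m (bound A) M)
          in subst (seq α i ≈[_] root i)
            (trans (cong (λ c → θ + c * (three * θ + θ + (θ + θ))) (ι≡/1 12)) (eq θ))
            (≈-trans (α≈a A i (ℕ.m⊔n≤o⇒m≤o (start A) (level A) M≤i))
              (oddPart-≈⁻¹ (a-unit A) (root-unit i) (level A)
                (≈-trans (≈-trans (≈-sym (odd-≈S A n N≤n)) (∣-∣≤⇒≈ (ℚ.<⇒≤ (h n M≤n))))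
                  (≈-weaken (ℚ.+-mono-≤ (mesh≤ A) (mesh≤ A))
                    (≈-sym (oddPart-root (ℕ.m⊔n≤o⇒n≤o (start A) (level A) M≤i)))))))
          where
          eq : ∀ t → t + + 12 / 1 * (three * t + t + (t + t)) ≡ + 73 / 1 * t
          eq = solve-∀ ring

      half⇒halvingShift : α Defs.≃ halvingShift
      half⇒halvingShift ε 0<ε =
        let (θ , 0<θ , θ≤½ , 100θ≤ε) = hundredth 0<ε
            A = approximations 0<θ θ≤½
        in start A ℕ.⊔ level A , λ i M≤i →
          ≈⇒∣-∣< (from-yes (+ 73 / 1 ℚ.<? hundred)) 0<θ 100θ≤ε (near-root 0<θ A i M≤i)

  module Halving (em : ExcludedMiddle 0ℓ) where

    open Counting em using (approximate)

    halvingShift-halves : ∀ ν → HalfOddHalfEven em halvingShift ν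
    halvingShift-halves ν = odd⟶½ A , even⟶½ A
      where
      A : ∀ {θ} → 0ℚ < θ → θ ≤ ½ →
        Approximation (density em halvingShift ν (+ 1) 2) (density em halvingShift ν (+ 2) 2) halvingShift θ
      A = approximate halvingShift ν 0≤halvingShift halvingShift≤1

    halvingShift-unique : ∀ ν α → Defs.0ℝ Defs.≤ α → α Defs.≤ Defs.1ℝ →
      HalfOddHalfEven em α ν → α Defs.≃ halvingShift
    halvingShift-unique ν α 0≤α α≤1 (odd , _) = half⇒halvingShift (approximate α ν 0≤α α≤1) odd

    uniqueHalvingShift : ∃ λ (α₀ : ℝ) → (Defs.0ℝ Defs.≤ α₀ × α₀ Defs.≤ Defs.1ℝ) ×
      (∀ (ν : ℝ) →
        HalfOddHalfEven em α₀ ν ×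
        (∀ (α : ℝ) → Defs.0ℝ Defs.≤ α → α Defs.≤ Defs.1ℝ → HalfOddHalfEven em α ν → α Defs.≃ α₀))
    uniqueHalvingShift = halvingShift , (0≤halvingShift , halvingShift≤1) , λ ν →
      halvingShift-halves ν , halvingShift-unique ν

open import Defs
open Development using (module Halving)

mainTheorem8 : (em : ExcludedMiddle 0ℓ) →
    ∃ λ (α₀ : ℝ) → (0ℝ ≤ α₀ × α₀ ≤ 1ℝ) ×
    (∀ (ν : ℝ) →
    HalfOddHalfEven em α₀ ν ×
    (∀ (α : ℝ) → 0ℝ ≤ α → α ≤ 1ℝ → HalfOddHalfEven em α ν → α ≃ α₀))
mainTheorem8 = Halving.uniqueHalvingShift
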